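{- Let $N\ge2$ be an integer and $x\in[0,1]\setminus\mathbb{Q}$. The topological dynamical systems $(X_{\omega(x,N)},\Sigma)$ and $(X_{\widehat\omega(x,N)},\Sigma)$ are uniquely ergodic, i.e. each has exactly one $\Sigma$-invariant (Borel) probability measure.
   Context: Let $N\ge 1$ be an integer and define $T_N:[0,1]\to[0,1]$ by $T_N(x)=\frac{N}{x}-\lfloor\frac{N}{x}\rfloor$ for $x\ne0$ and $T_N(0)=0$. For $x\in[0,1]\setminus\mathbb{Q}$ the (greedy) NCF digits of $x$ are $d_n=\lfloor N/T_N^{n-1}(x)\rfloor\ge N$, $n\ge1$; one writes $x=[0;d_1,d_2,\ldots]_N$. A substitution on $\{0,1\}$ is given by images of the letters (nonempty words) and extends to finite and infinite words by concatenation. For $x=[0;d_1,d_2,\ldots]_N$ irrational let $\sigma_n(0)=0^{d_n}1^N$, $\sigma_n(1)=0$ and $\widehat\sigma_n(0)=0^{d_n}1$, $\widehat\sigma_n(1)=0^N$ for $n\ge1$. The NCF sequence $\omega(x,N)\in\{0,1\}^{\mathbb N}$ is the unique infinite word $\omega$ for which there exist $\omega^{(1)},\omega^{(2)},\ldots\in\{0,1\}^{\mathbb{N}}$ with $\omega^{(1)}=\omega$ and $\omega^{(n)}=\sigma_n(\omega^{(n+1)})$ for all $n\ge1$. The dual NCF sequence $\widehat\omega(x,N)$ is defined in the same way with $\widehat\sigma_n$ in place of $\sigma_n$. $\{0,1\}^{\mathbb{N}}$ carries the product topology of the discrete topologies, $\Sigma$ is the left shift $\Sigma(\nu_0\nu_1\nu_2\cdots)=\nu_1\nu_2\cdots$,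 and for a sequence $\nu$, $X_\nu=\overline{\{\Sigma^n(\nu):n\in\mathbb{N}\}}$. -}

module Defs where

open import Level using (0ℓ) renaming (suc to lsuc)
open import Algebra.Bundles using (CommutativeRing; Semiring)
open import Axiom.ExcludedMiddle using (ExcludedMiddle)
open import Data.Fin.Base using (Fin; toℕ)
open import Data.Fin.Patterns using (0F; 1F)
open import Data.Integer.Base as ℤ using (ℤ; -[1+_])
open import Data.List.Base as List using ([]; _∷_)
open import Data.List.NonEmpty.Base as List⁺ using (List⁺; _∷_; _++⁺_; [_])
open import Data.Nat.Base as ℕ using (ℕ; zero; suc; NonZero; ≢-nonZero⁻¹; s<s)
open import Data.Nat.GeneralisedArithmetic using (fold)
open import Data.Product.Base using (∃; ∃-syntax; Σ-syntax; _×_; _,_; proj₁; proj₂)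
open import Data.Rational.Base using (ℚ; ↥_; ↧ₙ_)
open import Function.Base using (_∘_)
open import Relation.Binary.Core using (Rel)
open import Relation.Binary.Structures using (IsTotalOrder)
open import Relation.Binary.PropositionalEquality.Core using (_≡_; _≢_; cong)
open import Relation.Nullary using (¬_; yes; no)
open import Relation.Unary using (Pred; _∈_; _≐_; _⊢_; ∁; ⋃; ∅; U; _⊥_; Satisfiable)

import Algebra.Definitions.RawSemiring as RawSemiringDefinitions
import Relation.Binary.Construct.NonStrictToStrict as NonStrictToStrict

------------------------------------------------------------------------
-- The real numbers, axiomatised as a complete ordered field.  These axioms
-- determine ℝ up to isomorphism in a classical metatheory.

record CompleteOrderedField : Set₁ where
  infix 4 _≤_
  infix 8 _⁻¹
  field
    commutativeRing : CommutativeRing 0ℓ 0ℓ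
  open CommutativeRing commutativeRing public
  field
    _≤_          : Rel Carrier 0ℓ
    isTotalOrder : IsTotalOrder _≈_ _≤_
    +-monoʳ-≤    : ∀ z {x y} → x ≤ y → z + x ≤ z + y
    *-nonNeg     : ∀ {x y} → 0# ≤ x → 0# ≤ y → 0# ≤ x * y
    0≉1          : ¬ (0# ≈ 1#)
    -- The value 0# ⁻¹ is left unspecified.
    _⁻¹          : Carrier → Carrier
    ⁻¹-inverse   : ∀ x → ¬ (x ≈ 0#) → x * x ⁻¹ ≈ 1#

  UpperBound : Pred Carrier 0ℓ → Pred Carrier 0ℓ
  UpperBound P b = ∀ x → x ∈ P → x ≤ b

  field
    complete : (P : Pred Carrier 0ℓ) → Satisfiable P → Satisfiable (UpperBound P) →
               ∃[ s ] (s ∈ UpperBound P × (∀ b → b ∈ UpperBound P → s ≤ b))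

  open NonStrictToStrict _≈_ _≤_ public using (_<_)
  open RawSemiringDefinitions (Semiring.rawSemiring semiring) public using (sum) renaming (_×_ to _·_)

  fromℕ : ℕ → Carrier
  fromℕ n = n · 1#

  fromℤ : ℤ → Carrier
  fromℤ (ℤ.+ n)  = fromℕ n
  fromℤ -[1+ n ] = - fromℕ (suc n)

  fromℚ : ℚ → Carrier
  fromℚ q = fromℤ (↥ q) * fromℕ (↧ₙ q) ⁻¹

  Irrational : Pred Carrier 0ℓ
  Irrational x = ∀ q → ¬ (x ≈ fromℚ q)

  -- Convergence of the series f 0 + f 1 + f 2 + ⋯ to s.
  HasSum : (ℕ → Carrier) → Carrier → Set
  HasSum f s = ∀ ε → 0# < ε → ∃[ M ] (∀ m → M ℕ.≤ m →
    s - ε < partial m × partial m < s + ε)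
    where
    partial : ℕ → Carrier
    partial m = sum {m} (f ∘ toℕ)

------------------------------------------------------------------------
-- N-continued fractions.  Excluded middle turns the case distinction x = 0
-- and the floor into functions.

module NCF (em : ExcludedMiddle 0ℓ) (ℝ : CompleteOrderedField) where
  open CompleteOrderedField ℝ

  IsFloor : Carrier → ℕ → Set
  IsFloor y k = fromℕ k ≤ y × y < fromℕ (suc k)

  -- The floor of a non-negative real; negative reals, which have no floor in
  -- ℕ, are sent to 0.
  ⌊_⌋ : Carrier → ℕ
  ⌊ y ⌋ with em {∃ (IsFloor y)}
  ... | yes (k , _) = k
  ... | no _        = 0

  infixl 7 _/_
  _/_ : ℕ → Carrier → Carrier
  N / x = fromℕ N * x ⁻¹

  T : ℕ → Carrier → Carrier
  T N x with em {x ≈ 0#}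
  ... | yes _ = 0#
  ... | no _  = N / x - fromℕ ⌊ N / x ⌋

  -- digit N x n is the digit d_{n+1} of x.
  digit : ℕ → Carrier → ℕ → ℕ
  digit N x n = ⌊ N / fold x (T N) n ⌋

------------------------------------------------------------------------
-- Infinite words and substitutions

Letter : Set
Letter = Fin 2

Word : Set
Word = List⁺ Letter

Sequence : Set
Sequence = ℕ → Letter

concat∞ : (ℕ → Word) → Sequence
concat∞ ws = go (ws 0) (ws ∘ suc)
  where
  -- go w vs is the infinite word w · vs 0 · vs 1 · ⋯.
  go : Word → (ℕ → Word) → Sequence
  go (a ∷ _)      vs zero    = a
  go (_ ∷ [])     vs (suc k) = go (vs 0) (vs ∘ suc) k
  go (_ ∷ b ∷ bs) vs (suc k) = go (b ∷ bs) vs k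

Substitution : Set
Substitution = Letter → Word

apply : Substitution → Sequence → Sequence
apply τ ν = concat∞ (τ ∘ ν)

σ : (N : ℕ) .{{_ : NonZero N}} → ℕ → Substitution
σ N d 0F = List.replicate d 0F ++⁺ List⁺.replicate N (≢-nonZero⁻¹ N) 1F
σ N d 1F = [ 0F ]

σ̂ : (N : ℕ) .{{_ : NonZero N}} → ℕ → Substitution
σ̂ N d 0F = List.replicate d 0F ++⁺ [ 1F ]
σ̂ N d 1F = List⁺.replicate N (≢-nonZero⁻¹ N) 0F

-- ω is a limit word of τ 0, τ 1, …: it can be desubstituted indefinitely.
-- Equality of sequences is pointwise.
IsLimitWord : (ℕ → Substitution) → Pred Sequence 0ℓ
IsLimitWord τ ω =
  Σ[ Ω ∈ (ℕ → Sequence) ] ((∀ k → Ω 0 k ≡ ω k) ×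
                           (∀ n k → Ω n k ≡ apply (τ n) (Ω (suc n)) k))

module NCFSequence (em : ExcludedMiddle 0ℓ) (ℝ : CompleteOrderedField) where
  open CompleteOrderedField ℝ using (Carrier)
  open NCF em ℝ using (digit)

  -- For irrational x ∈ [0,1] exactly one sequence (up to pointwise equality)
  -- satisfies each of these predicates.
  IsNCFSequence : (N : ℕ) .{{_ : NonZero N}} → Carrier → Pred Sequence 0ℓ
  IsNCFSequence N x = IsLimitWord (λ n → σ N (digit N x n))

  IsDualNCFSequence : (N : ℕ) .{{_ : NonZero N}} → Carrier → Pred Sequence 0ℓ
  IsDualNCFSequence N x = IsLimitWord (λ n → σ̂ N (digit N x n))

------------------------------------------------------------------------
-- Topological dynamical systems

-- Open sets live one universe above points, so that the subspace topology can
-- be given by existence of an ambient open set.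
record DynamicalSystem : Set₂ where
  field
    Point      : Set
    Open       : Pred (Pred Point 0ℓ) (lsuc 0ℓ)
    step       : Point → Point
    continuous : ∀ {V} → Open V → Open (step ⊢ V)

-- Sets of points are compared extensionally, whence the last constructor.
data Borel {A : Set} (Open : Pred (Pred A 0ℓ) (lsuc 0ℓ)) : Pred (Pred A 0ℓ) (lsuc 0ℓ) where
  open-set   : ∀ {V} → Open V → Borel Open V
  complement : ∀ {V} → Borel Open V → Borel Open (∁ V)
  union      : {V : ℕ → Pred A 0ℓ} → (∀ n → Borel Open (V n)) → Borel Open (⋃ ℕ V)
  resp       : ∀ {V W} → V ≐ W → Borel Open V → Borel Open W

preimage-Borel : {A : Set} {Open : Pred (Pred A 0ℓ) (lsuc 0ℓ)} (f : A → A) →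
                 (∀ {V} → Open V → Open (f ⊢ V)) →
                 ∀ {V} → Borel Open V → Borel Open (f ⊢ V)
preimage-Borel f c (open-set o)         = open-set (c o)
preimage-Borel f c (complement b)       = complement (preimage-Borel f c b)
preimage-Borel f c (union bs)           = union (λ n → preimage-Borel f c (bs n))
preimage-Borel f c (resp (V⊆W , W⊆V) b) = resp (V⊆W , W⊆V) (preimage-Borel f c b)

module InvariantMeasures (ℝ : CompleteOrderedField) (S : DynamicalSystem) where
  open CompleteOrderedField ℝ
  open DynamicalSystem S

  BorelSet : Set₁
  BorelSet = ∃ (Borel Open)

  record ProbabilityMeasure : Set₁ where
    field
      μ        : BorelSet → Carrier
      μ-cong   : ∀ V W → proj₁ V ≐ proj₁ W → μ V ≈ μ W
      μ-nonNeg : ∀ V → 0# ≤ μ V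
      μ-∅      : (b : Borel Open ∅) → μ (∅ , b) ≈ 0#
      μ-U      : (b : Borel Open U) → μ (U , b) ≈ 1#
      μ-⋃      : (V : ℕ → Pred Point 0ℓ) (b : ∀ n → Borel Open (V n)) →
                 (∀ m n → m ≢ n → V m ⊥ V n) →
                 HasSum (λ n → μ (V n , b n)) (μ (⋃ ℕ V , union b))

  open ProbabilityMeasure public using (μ)

  step⁻¹ : BorelSet → BorelSet
  step⁻¹ (V , b) = (step ⊢ V) , preimage-Borel step continuous b

  Invariant : ProbabilityMeasure → Set₁
  Invariant m = ∀ V → μ m (step⁻¹ V) ≈ μ m V

  UniquelyErgodic : Set₁
  UniquelyErgodic = ∃[ m ] (Invariant m ×
                            (∀ m′ → Invariant m′ → ∀ V → μ m′ V ≈ μ m V))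

open InvariantMeasures public using (UniquelyErgodic)

------------------------------------------------------------------------
-- Orbit closures in the full shift

-- The words that agree with ν in the first n letters: a base of neighbourhoods
-- of ν in the product topology.
Cylinder : ℕ → Sequence → Pred Sequence 0ℓ
Cylinder n ν ν′ = ∀ i → i ℕ.< n → ν′ i ≡ ν i

OpenShift : Pred (Pred Sequence 0ℓ) 0ℓ
OpenShift V = ∀ ν → ν ∈ V → ∃[ n ] (∀ ν′ → ν′ ∈ Cylinder n ν → ν′ ∈ V)

Closure : Pred Sequence 0ℓ → Pred Sequence 0ℓ
Closure P ν = ∀ n → ∃[ ν′ ] (ν′ ∈ P × ν′ ∈ Cylinder n ν)

shift : Sequence → Sequence
shift ν = ν ∘ suc

Orbit : Sequence → Pred Sequence 0ℓ
Orbit ν ν′ = ∃[ n ] (ν′ ≡ fold ν shift n)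

X : Sequence → Pred Sequence 0ℓ
X ν = Closure (Orbit ν)

shift-X : ∀ ν {z} → z ∈ X ν → shift z ∈ X ν
shift-X ν z∈X n with z∈X (suc n)
... | ν′ , (m , ν′≡) , agree =
  shift ν′ , (suc m , cong shift ν′≡) , λ i i<n → agree (suc i) (s<s i<n)

shift-OpenShift : ∀ {V} → OpenShift V → OpenShift (shift ⊢ V)
shift-OpenShift oV ν ν∈V with oV (shift ν) ν∈V
... | n , cyl = suc n , λ ν′ agree → cyl (shift ν′) (λ i i<n → agree (suc i) (s<s i<n))

orbitClosure : Sequence → DynamicalSystem
orbitClosure ν = record
  { Point      = ∃ (X ν)
  ; Open       = λ V → ∃[ W ] (OpenShift W × V ≐ (proj₁ ⊢ W))
  ; step       = λ (z , z∈X) → shift z , shift-X ν z∈X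
  ; continuous = λ (W , oW , V⊆W , W⊆V) →
      (shift ⊢ W) , shift-OpenShift oW , V⊆W , W⊆V
  }

{-# OPTIONS --safe #-}

-- Uniform frequencies.  Every τ n maps both letters to words in which 0F occurs
-- at least as often as 1F, and the blocks of 0F are at least as long as those of
-- 1F; so at least half of each block of level n + 1 consists of blocks of 0F of
-- level n.  The Birkhoff sums of a locally constant function over the latter
-- agree up to a constant, hence the gap between the extreme averages over blocks
-- is halved at every level, up to an error of order 2⁻ⁿ.  In the limit all
-- averages along the orbit closure converge uniformly to a number, the rate.
--
-- Existence.  The rate extends to an outer measure: the measure of a set is the
-- infimum of the r for which some increasing sequence of locally constant
-- functions has rates at most r and is eventually at least 1 at each point of the
-- set.  Covering by increasing sequences instead of countable families makes
-- countable subadditivity a diagonal argument.  Borel sets satisfy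
-- Carathéodory's criterion, and compactness of the orbit closure gives mass 1.
--
-- Uniqueness.  An invariant measure of {f ≥ 1} is at most the rate of f, by
-- counting visits to this set along orbit segments.  So every invariant measure
-- is dominated by the outer measure, and complements turn this into equality.

module Submission where

open import Defs
open import Algebra.Bundles using (CommutativeRing)
open import Algebra.Solver.Ring.AlmostCommutativeRing using (fromCommutativeRing; _-Raw-AlmostCommutative⟶_)
open import Axiom.ExcludedMiddle using (ExcludedMiddle)
open import Data.Bool.Base using (Bool; true; false; not; if_then_else_)
open import Data.Empty using (⊥-elim)
open import Data.Fin.Base using (toℕ)
open import Data.Fin.Patterns using (0F; 1F)
open import Data.Integer.Base as ℤ using (ℤ; -[1+_])
open import Data.List.Base as List using (List; []; _∷_; _++_; length; concatMap)
open import Data.List.NonEmpty.Base as List⁺ using (toList; _∷_; _++⁺_)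
open import Data.Maybe.Base using (Maybe; just; nothing)
open import Data.Nat.Base as ℕ using (ℕ; zero; suc; z≤n; s≤s; NonZero; ≢-nonZero⁻¹)
open import Data.Nat.Coprimality using (Coprime; coprime-/gcd)
open import Data.Nat.GCD using (gcd; gcd[m,n]∣m; gcd[m,n]∣n; gcd[m,n]≢0)
open import Data.Nat.GeneralisedArithmetic using (fold)
open import Data.Nat.Solver using (module +-*-Solver)
open import Data.Product.Base using (∃; ∃-syntax; Σ-syntax; _×_; _,_; proj₁; proj₂)
open import Data.Rational.Base using (mkℚ)
open import Data.Sum.Base using (inj₁; inj₂)
open import Data.Unit.Base using (⊤; tt)
open import Function.Base using (_∘_; id)
open import Level using (0ℓ)
open import Relation.Binary.Bundles using (Poset)
open import Relation.Binary.Definitions using (tri<; tri≈; tri>)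
open import Relation.Binary.PropositionalEquality as ≡ using (_≡_; _≢_; _≗_)
open import Relation.Binary.Structures using (IsTotalOrder)
open import Relation.Nullary using (¬_; yes; no; does)
open import Relation.Unary using (Pred; _∈_; _⊆_; _≐_; _⊢_; ∁; ⋃; ∅; U; _⊥_; _∩_)

import Algebra.Properties.Ring as RingProperties
import Algebra.Properties.Semiring.Mult as SemiringMult
import Algebra.Properties.Semiring.Mult.TCOptimised as Mult
import Algebra.Solver.Ring as RingSolver
import Data.Integer.Properties as ℤ
import Data.List.Properties as List
import Data.Nat.DivMod as ℕ
import Data.Nat.Properties as ℕ
import Relation.Binary.Reasoning.PartialOrder as PosetReasoning
import Relation.Binary.Reasoning.Setoid as SetoidReasoning

-- Ordered fields

-- The ring solver is run with integer coefficients, whose equality can be decided by computation;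
-- the canonical homomorphism interprets them in `R`.
module IntegerCoefficients {c ℓ} (R : CommutativeRing c ℓ) where
  open CommutativeRing R
  open RingProperties ring
  open Mult semiring renaming (_×_ to _·_)
  open SetoidReasoning setoid

  ⟦_⟧ℤ : ℤ → Carrier
  ⟦ ℤ.+ n ⟧ℤ     = n · 1#
  ⟦ -[1+ n ] ⟧ℤ = - (suc n · 1#)

  ⊖-homo : ∀ m n → ⟦ m ℤ.⊖ n ⟧ℤ ≈ m · 1# - n · 1#
  ⊖-homo m zero = begin
    m · 1#          ≈⟨ +-identityʳ _ ⟨
    m · 1# + 0#     ≈⟨ +-congˡ -0#≈0# ⟨
    m · 1# - 0#     ∎
  ⊖-homo zero (suc n) = sym (+-identityˡ _)
  ⊖-homo (suc m) (suc n) = begin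
    ⟦ suc m ℤ.⊖ suc n ⟧ℤ                 ≡⟨ ≡.cong ⟦_⟧ℤ (ℤ.[1+m]⊖[1+n]≡m⊖n m n) ⟩
    ⟦ m ℤ.⊖ n ⟧ℤ                         ≈⟨ ⊖-homo m n ⟩
    m · 1# - n · 1#                      ≈⟨ +-congˡ (+-identityˡ _) ⟨
    m · 1# + (0# - n · 1#)               ≈⟨ +-congˡ (+-congʳ (-‿inverseʳ 1#)) ⟨
    m · 1# + ((1# - 1#) - n · 1#)        ≈⟨ +-congˡ (+-assoc _ _ _) ⟩
    m · 1# + (1# + (- 1# - n · 1#))      ≈⟨ +-assoc _ _ _ ⟨
    (m · 1# + 1#) + (- 1# - n · 1#)      ≈⟨ +-cong (trans (+-comm _ _) (sym (1+× m 1#))) (trans (-‿+-comm _ _) (-‿cong (sym (1+× n 1#)))) ⟩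
    suc m · 1# - suc n · 1#              ∎

  -‿homo : ∀ i → ⟦ ℤ.- i ⟧ℤ ≈ - ⟦ i ⟧ℤ
  -‿homo (ℤ.+ zero)    = sym -0#≈0#
  -‿homo (ℤ.+ (suc n)) = refl
  -‿homo -[1+ n ]      = sym (-‿involutive _)

  +-homo : ∀ i j → ⟦ i ℤ.+ j ⟧ℤ ≈ ⟦ i ⟧ℤ + ⟦ j ⟧ℤ
  +-homo (ℤ.+ m)  (ℤ.+ n)  = ×-homo-+ 1# m n
  +-homo (ℤ.+ m)  -[1+ n ] = ⊖-homo m (suc n)
  +-homo -[1+ m ] (ℤ.+ n)  = trans (⊖-homo n (suc m)) (+-comm _ _)
  +-homo -[1+ m ] -[1+ n ] = begin
    - (suc (suc (m ℕ.+ n)) · 1#)         ≡⟨ ≡.cong (λ k → - (suc k · 1#)) (ℕ.+-suc m n) ⟨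
    - ((suc m ℕ.+ suc n) · 1#)           ≈⟨ -‿cong (×-homo-+ 1# (suc m) (suc n)) ⟩
    - (suc m · 1# + suc n · 1#)          ≈⟨ -‿+-comm _ _ ⟨
    - (suc m · 1#) - suc n · 1#          ∎

  *-homo-+ : ∀ m n → ⟦ ℤ.+ m ℤ.* ℤ.+ n ⟧ℤ ≈ m · 1# * n · 1#
  *-homo-+ m n = begin
    ⟦ ℤ.+ m ℤ.* ℤ.+ n ⟧ℤ ≡⟨ ≡.cong ⟦_⟧ℤ (ℤ.pos-* m n) ⟨
    (m ℕ.* n) · 1#       ≈⟨ ×1-homo-* m n ⟩
    m · 1# * n · 1#      ∎

  *-homoʳ : ∀ m j → ⟦ ℤ.+ m ℤ.* j ⟧ℤ ≈ m · 1# * ⟦ j ⟧ℤ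
  *-homoʳ m (ℤ.+ n)  = *-homo-+ m n
  *-homoʳ m -[1+ n ] = begin
    ⟦ ℤ.+ m ℤ.* (ℤ.- ℤ.+ suc n) ⟧ℤ  ≡⟨ ≡.cong ⟦_⟧ℤ (ℤ.neg-distribʳ-* (ℤ.+ m) (ℤ.+ suc n)) ⟨
    ⟦ ℤ.- (ℤ.+ m ℤ.* ℤ.+ suc n) ⟧ℤ  ≈⟨ -‿homo (ℤ.+ m ℤ.* ℤ.+ suc n) ⟩
    - ⟦ ℤ.+ m ℤ.* ℤ.+ suc n ⟧ℤ      ≈⟨ -‿cong (*-homo-+ m (suc n)) ⟩
    - (m · 1# * suc n · 1#)         ≈⟨ -‿distribʳ-* _ _ ⟩
    m · 1# * - (suc n · 1#)         ∎

  *-homo : ∀ i j → ⟦ i ℤ.* j ⟧ℤ ≈ ⟦ i ⟧ℤ * ⟦ j ⟧ℤ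
  *-homo (ℤ.+ m) j = *-homoʳ m j
  *-homo -[1+ m ] j = begin
    ⟦ (ℤ.- ℤ.+ suc m) ℤ.* j ⟧ℤ      ≡⟨ ≡.cong ⟦_⟧ℤ (ℤ.neg-distribˡ-* (ℤ.+ suc m) j) ⟨
    ⟦ ℤ.- (ℤ.+ suc m ℤ.* j) ⟧ℤ      ≈⟨ -‿homo (ℤ.+ suc m ℤ.* j) ⟩
    - ⟦ ℤ.+ suc m ℤ.* j ⟧ℤ          ≈⟨ -‿cong (*-homoʳ (suc m) j) ⟩
    - (suc m · 1# * ⟦ j ⟧ℤ)         ≈⟨ -‿distribˡ-* _ _ ⟩
    - (suc m · 1#) * ⟦ j ⟧ℤ         ∎

  homomorphism : ℤ.+-*-rawRing -Raw-AlmostCommutative⟶ fromCommutativeRing R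
  homomorphism = record
    { ⟦_⟧ = ⟦_⟧ℤ ; +-homo = +-homo ; *-homo = *-homo ; -‿homo = -‿homo
    ; 0-homo = refl ; 1-homo = refl }

  _≟_ : ∀ i j → Maybe (⟦ i ⟧ℤ ≈ ⟦ j ⟧ℤ)
  i ≟ j with i ℤ.≟ j
  ... | yes i≡j = just (reflexive (≡.cong ⟦_⟧ℤ i≡j))
  ... | no _    = nothing

  open RingSolver ℤ.+-*-rawRing (fromCommutativeRing R) homomorphism _≟_ public
    using (Polynomial; solve; _:=_; _:+_; _:*_; _:-_; :-_; con)

module OrderedField (em : ExcludedMiddle 0ℓ) (ℝ : CompleteOrderedField) where
  open CompleteOrderedField ℝ public hiding (zero)
  open IntegerCoefficients commutativeRing public using (Polynomial; solve; _:=_; _:+_; _:*_; _:-_; :-_; con)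

  poset : Poset 0ℓ 0ℓ 0ℓ
  poset = record { isPartialOrder = IsTotalOrder.isPartialOrder isTotalOrder }
  open Poset poset public using (antisym; ≤-respˡ-≈; ≤-respʳ-≈)
    renaming (refl to ≤-refl; reflexive to ≤-reflexive; trans to ≤-trans)
  module ≤-Reasoning = PosetReasoning poset
  open IsTotalOrder isTotalOrder public using () renaming (total to ≤-total)

  𝟙 : ∀ {n} → Polynomial n
  𝟙 {n} = con {n} (ℤ.+ 1)

  +-mono-≤ : ∀ {a b c d} → a ≤ b → c ≤ d → a + c ≤ b + d
  +-mono-≤ {a} {b} {c} {d} a≤b c≤d = begin
    a + c ≤⟨ +-monoʳ-≤ a c≤d ⟩
    a + d ≈⟨ +-comm a d ⟩
    d + a ≤⟨ +-monoʳ-≤ d a≤b ⟩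
    d + b ≈⟨ +-comm d b ⟩
    b + d ∎
    where open ≤-Reasoning

  -- The common form of all linear arithmetic below: the known inequalities are added up to `a ≤ b`,
  -- and the ring solver checks that both inequalities have the same difference of sides.
  linear : ∀ {a b c d} → a ≤ b → d - c ≈ b - a → c ≤ d
  linear {a} {b} {c} {d} a≤b eq = begin
    c               ≈⟨ solve 2 (λ a c → c := (c :- a) :+ a) refl a c ⟩
    (c - a) + a     ≤⟨ +-monoʳ-≤ (c - a) a≤b ⟩
    (c - a) + b     ≈⟨ solve 3 (λ a b c → (c :- a) :+ b := c :+ (b :- a)) refl a b c ⟩
    c + (b - a)     ≈⟨ +-congˡ (sym eq) ⟩
    c + (d - c)     ≈⟨ solve 2 (λ c d → c :+ (d :- c) := d) refl c d ⟩
    d               ∎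
    where open ≤-Reasoning

  x≤y⇒0≤y-x : ∀ {x y} → x ≤ y → 0# ≤ y - x
  x≤y⇒0≤y-x {x} {y} x≤y = linear x≤y (solve 2 (λ x y → (y :- x) :- con (ℤ.+ 0) := y :- x) refl x y)

  *-monoˡ-≤ : ∀ {x y z} → 0# ≤ z → x ≤ y → z * x ≤ z * y
  *-monoˡ-≤ {x} {y} {z} 0≤z x≤y = linear (*-nonNeg 0≤z (x≤y⇒0≤y-x x≤y))
    (solve 3 (λ x y z → z :* y :- z :* x := z :* (y :- x) :- con (ℤ.+ 0)) refl x y z)

  *-monoʳ-≤ : ∀ {x y z} → 0# ≤ z → x ≤ y → x * z ≤ y * z
  *-monoʳ-≤ {x} {y} {z} 0≤z x≤y = ≤-respˡ-≈ (*-comm z x) (≤-respʳ-≈ (*-comm z y) (*-monoˡ-≤ 0≤z x≤y))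

  ≰⇒> : ∀ {x y} → ¬ (x ≤ y) → y < x
  ≰⇒> {x} {y} x≰y with ≤-total x y
  ... | inj₁ x≤y = ⊥-elim (x≰y x≤y)
  ... | inj₂ y≤x = y≤x , λ y≈x → x≰y (≤-reflexive (sym y≈x))

  <⇒≱ : ∀ {x y} → x < y → ¬ (y ≤ x)
  <⇒≱ (x≤y , x≉y) y≤x = x≉y (antisym x≤y y≤x)

  0≤1 : 0# ≤ 1#
  0≤1 with ≤-total 0# 1#
  ... | inj₁ 0≤1 = 0≤1
  ... | inj₂ 1≤0 = ≤-respʳ-≈ (solve 0 (:- 𝟙 :* :- 𝟙 := 𝟙) refl) (*-nonNeg 0≤-1 0≤-1)
    where
    0≤-1 : 0# ≤ - 1#
    0≤-1 = linear 1≤0 (solve 0 (:- 𝟙 :- con (ℤ.+ 0) := con (ℤ.+ 0) :- 𝟙) refl)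

  0<1 : 0# < 1#
  0<1 = 0≤1 , 0≉1

  *-pos : ∀ {x y} → 0# < x → 0# < y → 0# < x * y
  *-pos {x} {y} (0≤x , 0≉x) (0≤y , 0≉y) = *-nonNeg 0≤x 0≤y , λ 0≈xy → 0≉y (begin
    0#             ≈⟨ zeroʳ _ ⟨
    x ⁻¹ * 0#      ≈⟨ *-congˡ 0≈xy ⟩
    x ⁻¹ * (x * y) ≈⟨ solve 3 (λ i x y → i :* (x :* y) := (x :* i) :* y) refl (x ⁻¹) x y ⟩
    x * x ⁻¹ * y   ≈⟨ *-congʳ (⁻¹-inverse x (λ x≈0 → 0≉x (sym x≈0))) ⟩
    1# * y         ≈⟨ *-identityˡ y ⟩
    y              ∎)
    where open SetoidReasoning setoid

  ⁻¹-inverseʳ : ∀ {x} → 0# < x → x * x ⁻¹ ≈ 1#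
  ⁻¹-inverseʳ {x} (_ , 0≉x) = ⁻¹-inverse x (λ x≈0 → 0≉x (sym x≈0))

  ⁻¹-pos : ∀ {x} → 0# < x → 0# < x ⁻¹
  ⁻¹-pos {x} 0<x@(0≤x , _) with em {0# ≤ x ⁻¹}
  ... | yes 0≤i = 0≤i , λ 0≈i → 0≉1 (trans (sym (zeroʳ x)) (trans (*-congˡ 0≈i) (⁻¹-inverseʳ 0<x)))
  ... | no 0≰i  = ⊥-elim (<⇒≱ 0<1 (≤-respʳ-≈ (zeroʳ x) (≤-respˡ-≈ (⁻¹-inverseʳ 0<x) (*-monoˡ-≤ 0≤x (proj₁ (≰⇒> 0≰i))))))

  *-cancelˡ-≤ : ∀ {x y z} → 0# < z → z * x ≤ z * y → x ≤ y
  *-cancelˡ-≤ {x} {y} {z} 0<z zx≤zy = begin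
    x              ≈⟨ *-identityˡ x ⟨
    1# * x         ≈⟨ *-congʳ (⁻¹-inverseʳ 0<z) ⟨
    z * z ⁻¹ * x   ≈⟨ swap x ⟩
    z ⁻¹ * (z * x) ≤⟨ *-monoˡ-≤ (proj₁ (⁻¹-pos 0<z)) zx≤zy ⟩
    z ⁻¹ * (z * y) ≈⟨ swap y ⟨
    z * z ⁻¹ * y   ≈⟨ *-congʳ (⁻¹-inverseʳ 0<z) ⟩
    1# * y         ≈⟨ *-identityˡ y ⟩
    y              ∎
    where
    open ≤-Reasoning
    swap : ∀ w → z * z ⁻¹ * w ≈ z ⁻¹ * (z * w)
    swap w = solve 3 (λ z i w → z :* i :* w := i :* (z :* w)) refl z (z ⁻¹) w

  open SemiringMult semiring using (×-homo-+; ×1-homo-*)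

  fromℕ-+ : ∀ m n → fromℕ (m ℕ.+ n) ≈ fromℕ m + fromℕ n
  fromℕ-+ = ×-homo-+ 1#

  fromℕ-* : ∀ m n → fromℕ (m ℕ.* n) ≈ fromℕ m * fromℕ n
  fromℕ-* = ×1-homo-*

  fromℕ-1 : fromℕ 1 ≈ 1#
  fromℕ-1 = +-identityʳ 1#

  0≤fromℕ : ∀ n → 0# ≤ fromℕ n
  0≤fromℕ zero    = ≤-refl
  0≤fromℕ (suc n) = ≤-respˡ-≈ (+-identityˡ 0#) (+-mono-≤ 0≤1 (0≤fromℕ n))

  fromℕ-mono-≤ : ∀ {m n} → m ℕ.≤ n → fromℕ m ≤ fromℕ n
  fromℕ-mono-≤ {n = n} z≤n = 0≤fromℕ n
  fromℕ-mono-≤ (s≤s m≤n) = +-monoʳ-≤ 1# (fromℕ-mono-≤ m≤n)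

  0<fromℕ-suc : ∀ n → 0# < fromℕ (suc n)
  0<fromℕ-suc n = 0≤fromℕ (suc n) , λ eq →
    <⇒≱ 0<1 (≤-respʳ-≈ (sym eq) (≤-respˡ-≈ fromℕ-1 (fromℕ-mono-≤ {1} {suc n} (s≤s z≤n))))

  ½ : Carrier
  ½ = (1# + 1#) ⁻¹

  <-respʳ-≈ : ∀ {x y z} → y ≈ z → x < y → x < z
  <-respʳ-≈ y≈z (x≤y , x≉y) = ≤-respʳ-≈ y≈z x≤y , λ x≈z → x≉y (trans x≈z (sym y≈z))

  0<1+1 : 0# < 1# + 1#
  0<1+1 = <-respʳ-≈ (+-congˡ fromℕ-1) (0<fromℕ-suc 1)

  0<½ : 0# < ½
  0<½ = ⁻¹-pos 0<1+1

  ½-double : ∀ x → ½ * x + ½ * x ≈ x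
  ½-double x = trans (solve 2 (λ h x → h :* x :+ h :* x := ((𝟙 :+ 𝟙) :* h) :* x) refl ½ x)
    (trans (*-congʳ (⁻¹-inverseʳ 0<1+1)) (*-identityˡ x))

  ≤-fromε : ∀ {x y} → (∀ ε → 0# < ε → x ≤ y + ε) → x ≤ y
  ≤-fromε {x} {y} h with em {x ≤ y}
  ... | yes x≤y = x≤y
  ... | no x≰y  = ⊥-elim (<⇒≱ 0<δ δ≤0)
    where
    y<x = ≰⇒> x≰y
    0<d : 0# < x - y
    0<d = x≤y⇒0≤y-x (proj₁ y<x) , λ 0≈d → proj₂ y<x (trans (sym (+-identityˡ y)) (trans (+-congʳ 0≈d) (solve 2 (λ x y → (x :- y) :+ y := x) refl x y)))
    -- Half the gap is a fatal choice of `ε`: since `x - y` is twice `δ`, the hypothesis says that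
    -- twice `δ` is at most `δ`.
    δ = ½ * (x - y)
    0<δ : 0# < δ
    0<δ = *-pos 0<½ 0<d
    δ≤0 : δ ≤ 0#
    δ≤0 = linear (h δ 0<δ) (trans (solve 1 (λ d → con (ℤ.+ 0) :- d := d :- (d :+ d)) refl δ)
      (trans (+-congˡ (-‿cong (½-double _))) (solve 3 (λ x y d → d :- (x :- y) := y :+ d :- x) refl x y δ)))

  -- If `x` bounded all natural numbers, the set `P` of reals below some natural number would have a
  -- supremum `s`. As `P` is closed under adding 1, `s - 1#` would be an upper bound as well.
  archimedean : ∀ x → ∃[ n ] x ≤ fromℕ n
  archimedean x with em {∃[ n ] x ≤ fromℕ n}
  ... | yes found = found
  ... | no none   = ⊥-elim (<⇒≱ 0<1 1≤0)
    where
    P : Carrier → Set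
    P y = ∃[ n ] y ≤ fromℕ n
    sup = complete P (0# , 0 , ≤-refl) (x , λ y (n , y≤n) → ≤-trans y≤n (proj₁ (≰⇒> (λ x≤n → none (n , x≤n)))))
    s = proj₁ sup
    s≤s-1 : s ≤ s - 1#
    s≤s-1 = proj₂ (proj₂ sup) (s - 1#) λ y (n , y≤n) → linear (proj₁ (proj₂ sup) (1# + y) (suc n , +-monoʳ-≤ 1# y≤n))
      (solve 2 (λ s y → s :- 𝟙 :- y := s :- (𝟙 :+ y)) refl s y)
    1≤0 : 1# ≤ 0#
    1≤0 = linear s≤s-1 (solve 1 (λ s → con (ℤ.+ 0) :- 𝟙 := s :- 𝟙 :- s) refl s)

  archimedean-* : ∀ x {ε} → 0# < ε → ∃[ n ] x ≤ ε * fromℕ n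
  archimedean-* x {ε} 0<ε = let n , le = archimedean (ε ⁻¹ * x) in n , *-cancelˡ-≤ (⁻¹-pos 0<ε) (≤-trans le (≤-reflexive (sym (trans (solve 3 (λ i e n → i :* (e :* n) := (e :* i) :* n) refl (ε ⁻¹) ε (fromℕ n))
    (trans (*-congʳ (⁻¹-inverseʳ 0<ε)) (*-identityˡ _))))))

  -- Division by `k` turns the constant `C` into an error that tends to 0. This is how bounds on
  -- sums become bounds on averages.
  slope-≤ : ∀ {x y} C → (∀ k → fromℕ k * x ≤ fromℕ k * y + C) → x ≤ y
  slope-≤ {x} {y} C h = ≤-fromε λ ε 0<ε → step ε 0<ε (archimedean-* C 0<ε)
    where
    step : ∀ ε → 0# < ε → ∃[ n ] C ≤ ε * fromℕ n → x ≤ y + ε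
    step ε 0<ε (n , C≤εn) = *-cancelˡ-≤ (0<fromℕ-suc n) (begin
      fromℕ (suc n) * x                     ≤⟨ h (suc n) ⟩
      fromℕ (suc n) * y + C                 ≤⟨ +-monoʳ-≤ _ (≤-trans C≤εn (*-monoˡ-≤ (proj₁ 0<ε) (fromℕ-mono-≤ (ℕ.n≤1+n n)))) ⟩
      fromℕ (suc n) * y + ε * fromℕ (suc n) ≈⟨ solve 3 (λ n y e → n :* y :+ e :* n := n :* (y :+ e)) refl (fromℕ (suc n)) y ε ⟩
      fromℕ (suc n) * (y + ε)               ∎)
      where open ≤-Reasoning

  ½^_ : ℕ → Carrier
  ½^ zero  = 1#
  ½^ suc n = ½ * ½^ n

  0<½^ : ∀ n → 0# < ½^ n
  0<½^ zero    = 0<1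
  0<½^ (suc n) = *-pos 0<½ (0<½^ n)

  ½^-+ : ∀ m n → ½^ (m ℕ.+ n) ≈ ½^ m * ½^ n
  ½^-+ zero    n = sym (*-identityˡ _)
  ½^-+ (suc m) n = trans (*-congˡ (½^-+ m n)) (sym (*-assoc _ _ _))

  ½^≤1 : ∀ n → ½^ n ≤ 1#
  ½^≤1 zero    = ≤-refl
  ½^≤1 (suc n) = begin
    ½ * ½^ n              ≈⟨ +-identityʳ _ ⟨
    ½ * ½^ n + 0#         ≤⟨ +-monoʳ-≤ _ (*-nonNeg (proj₁ 0<½) (proj₁ (0<½^ n))) ⟩
    ½ * ½^ n + ½ * ½^ n   ≈⟨ ½-double _ ⟩
    ½^ n                  ≤⟨ ½^≤1 n ⟩
    1#                    ∎
    where open ≤-Reasoning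

  -- This is `n + 1 ≤ 2ⁿ` in division-free form.
  ½^-linear : ∀ n → ½^ n * fromℕ (suc n) ≤ 1#
  ½^-linear zero    = ≤-reflexive (trans (*-identityˡ _) fromℕ-1)
  ½^-linear (suc n) = begin
    ½ * ½^ n * (1# + fromℕ (suc n))         ≈⟨ solve 3 (λ h p n → h :* p :* (𝟙 :+ n) := h :* p :+ h :* (p :* n)) refl ½ (½^ n) (fromℕ (suc n)) ⟩
    ½ * ½^ n + ½ * (½^ n * fromℕ (suc n))   ≤⟨ +-mono-≤ (*-monoˡ-≤ (proj₁ 0<½) (½^≤1 n)) (*-monoˡ-≤ (proj₁ 0<½) (½^-linear n)) ⟩
    ½ * 1# + ½ * 1#                         ≈⟨ ½-double 1# ⟩
    1#                                      ∎
    where open ≤-Reasoning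

  ½^-small : ∀ B {ε} → 0# < ε → ∃[ n ] B * ½^ n ≤ ε
  ½^-small B {ε} 0<ε = let n , B≤εn = archimedean-* B 0<ε in n , (begin
    B * ½^ n                    ≤⟨ *-monoʳ-≤ (proj₁ (0<½^ n)) (≤-trans B≤εn (*-monoˡ-≤ (proj₁ 0<ε) (fromℕ-mono-≤ (ℕ.n≤1+n n)))) ⟩
    ε * fromℕ (suc n) * ½^ n    ≈⟨ solve 3 (λ e n p → e :* n :* p := e :* (p :* n)) refl ε (fromℕ (suc n)) (½^ n) ⟩
    ε * (½^ n * fromℕ (suc n))  ≤⟨ *-monoˡ-≤ (proj₁ 0<ε) (½^-linear n) ⟩
    ε * 1#                      ≈⟨ *-identityʳ ε ⟩
    ε                           ∎)
    where open ≤-Reasoning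

  -- At an even exponent `n + n`, one factor `½^ n` absorbs the linear factor and the other one
  -- makes the product small.
  ½^-linear-small : ∀ B {ε} → 0# ≤ B → 0# < ε → ∃[ n ] B * fromℕ (suc n) * ½^ n ≤ ε
  ½^-linear-small B {ε} 0≤B 0<ε = let n , le = ½^-small (B + B) 0<ε in n ℕ.+ n , (begin
    B * fromℕ (suc (n ℕ.+ n)) * ½^ (n ℕ.+ n)          ≤⟨ *-monoʳ-≤ (proj₁ (0<½^ (n ℕ.+ n))) (*-monoˡ-≤ 0≤B (fromℕ-mono-≤ (s≤s (ℕ.+-monoʳ-≤ n (ℕ.n≤1+n n))))) ⟩
    B * fromℕ (suc n ℕ.+ suc n) * ½^ (n ℕ.+ n)        ≈⟨ *-cong (*-congˡ (fromℕ-+ (suc n) (suc n))) (½^-+ n n) ⟩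
    B * (fromℕ (suc n) + fromℕ (suc n)) * (½^ n * ½^ n) ≈⟨ solve 3 (λ B n p → B :* (n :+ n) :* (p :* p) := (B :+ B) :* p :* (p :* n)) refl B (fromℕ (suc n)) (½^ n) ⟩
    (B + B) * ½^ n * (½^ n * fromℕ (suc n))           ≤⟨ *-monoˡ-≤ (*-nonNeg 0≤2B (proj₁ (0<½^ n))) (½^-linear n) ⟩
    (B + B) * ½^ n * 1#                               ≈⟨ *-identityʳ _ ⟩
    (B + B) * ½^ n                                    ≤⟨ le ⟩
    ε                                                 ∎)
    where
    open ≤-Reasoning
    0≤2B : 0# ≤ B + B
    0≤2B = ≤-respˡ-≈ (+-identityˡ 0#) (+-mono-≤ 0≤B 0≤B)

-- Words, substitutions and Birkhoff sums

module Words where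
  open import Data.Nat.Base using (_+_; _*_; _≤_; _<_; pred; >-nonZero; z<s; s<s)
  open import Data.Nat.Properties
  open import Relation.Binary.PropositionalEquality

  infixr 5 _∷∞_ _++∞_

  _∷∞_ : Letter → Sequence → Sequence
  (a ∷∞ z) zero    = a
  (a ∷∞ z) (suc k) = z k

  _++∞_ : List Letter → Sequence → Sequence
  []      ++∞ z = z
  (a ∷ w) ++∞ z = a ∷∞ (w ++∞ z)

  drop : ℕ → Sequence → Sequence
  drop n z i = z (n + i)

  ∷∞-cong : ∀ a {y z} → y ≗ z → a ∷∞ y ≗ a ∷∞ z
  ∷∞-cong a y≗z zero    = refl
  ∷∞-cong a y≗z (suc k) = y≗z k

  ∷∞-η : ∀ z → z ≗ z 0 ∷∞ shift z
  ∷∞-η z zero    = refl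
  ∷∞-η z (suc k) = refl

  ++∞-cong : ∀ w {y z} → y ≗ z → w ++∞ y ≗ w ++∞ z
  ++∞-cong []      y≗z = y≗z
  ++∞-cong (a ∷ w) y≗z = ∷∞-cong a (++∞-cong w y≗z)

  ++∞-assoc : ∀ v w z → (v ++ w) ++∞ z ≗ v ++∞ (w ++∞ z)
  ++∞-assoc []      w z k = refl
  ++∞-assoc (a ∷ v) w z   = ∷∞-cong a (++∞-assoc v w z)

  drop-++∞ : ∀ w z → drop (length w) (w ++∞ z) ≗ z
  drop-++∞ []      z k = refl
  drop-++∞ (a ∷ w) z   = drop-++∞ w z

  ++∞-prefix : ∀ w y z → w ++∞ y ∈ Cylinder (length w) (w ++∞ z)
  ++∞-prefix (a ∷ w) y z zero    _         = refl
  ++∞-prefix (a ∷ w) y z (suc i) (s<s i<n) = ++∞-prefix w y z i i<n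

  fold-shift : ∀ ω n → fold ω shift n ≗ drop n ω
  fold-shift ω zero    i = refl
  fold-shift ω (suc n) i = trans (fold-shift ω n (suc i)) (cong ω (+-suc n i))

  private
    -- The local recursion inside `concat∞` passes through states consisting of a partly read word
    -- and the words after it. Each such state is `concat∞ (prepend w ws)`, so that inductions over
    -- the recursion can be stated.
    prepend : Word → (ℕ → Word) → ℕ → Word
    prepend w ws zero    = w
    prepend w ws (suc n) = ws n

    concat∞-prepend : ∀ w ws → concat∞ (prepend w ws) ≗ toList w ++∞ concat∞ ws
    concat∞-prepend (a ∷ as)     ws zero    = refl
    concat∞-prepend (a ∷ [])     ws (suc k) = refl
    concat∞-prepend (a ∷ b ∷ bs) ws (suc k) = concat∞-prepend (b ∷ bs) ws k

    concat∞-prepend-cong : ∀ w {vs ws} → vs ≗ ws → concat∞ (prepend w vs) ≗ concat∞ (prepend w ws)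
    concat∞-prepend-cong (a ∷ as)     vs≗ws zero    = refl
    concat∞-prepend-cong (a ∷ b ∷ bs) vs≗ws (suc k) = concat∞-prepend-cong (b ∷ bs) vs≗ws k
    concat∞-prepend-cong (a ∷ []) {vs} {ws} vs≗ws (suc k) = trans
      (cong (λ w → concat∞ (prepend w (vs ∘ suc)) k) (vs≗ws 0))
      (concat∞-prepend-cong (ws 0) (vs≗ws ∘ suc) k)

  image : Substitution → List Letter → List Letter
  image τ = concatMap (toList ∘ τ)

  module _ (τ : Substitution) where

    apply-cong : ∀ {y z} → y ≗ z → apply τ y ≗ apply τ z
    apply-cong {y} {z} y≗z k = trans
      (cong (λ w → concat∞ (prepend w (τ ∘ y ∘ suc)) k) (cong τ (y≗z 0)))
      (concat∞-prepend-cong (τ (z 0)) (λ i → cong τ (y≗z (suc i))) k)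

    apply-++∞ : ∀ w z → apply τ (w ++∞ z) ≗ image τ w ++∞ apply τ z
    apply-++∞ []      z k = refl
    apply-++∞ (a ∷ w) z k = begin
      apply τ (a ∷∞ (w ++∞ z)) k                   ≡⟨ concat∞-prepend (τ a) (τ ∘ (w ++∞ z)) k ⟩
      (toList (τ a) ++∞ apply τ (w ++∞ z)) k       ≡⟨ ++∞-cong (toList (τ a)) (apply-++∞ w z) k ⟩
      (toList (τ a) ++∞ image τ w ++∞ apply τ z) k ≡⟨ ++∞-assoc (toList (τ a)) (image τ w) (apply τ z) k ⟨
      (image τ (a ∷ w) ++∞ apply τ z) k            ∎
      where open ≡-Reasoning

  -- Locally constant functions, with an explicit number of letters on which they depend. Values in
  -- ℕ keep all Birkhoff sums natural numbers.
  record Simple : Set where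
    field
      value   : Sequence → ℕ
      window  : ℕ
      bound   : ℕ
      local   : ∀ {y z} → y ∈ Cylinder window z → value y ≡ value z
      bounded : ∀ z → value z ≤ bound
  open Simple public

  birkhoff : (Sequence → ℕ) → ℕ → Sequence → ℕ
  birkhoff f zero    z = 0
  birkhoff f (suc k) z = f z + birkhoff f k (shift z)

  birkhoff-+ : ∀ f i j z → birkhoff f (i + j) z ≡ birkhoff f i z + birkhoff f j (drop i z)
  birkhoff-+ f zero    j z = refl
  birkhoff-+ f (suc i) j z = trans (cong (f z +_) (birkhoff-+ f i j (shift z))) (sym (+-assoc (f z) _ _))

  shift-Cylinder : ∀ {n y z} → y ∈ Cylinder (suc n) z → shift y ∈ Cylinder n (shift z)
  shift-Cylinder y∈ i i<n = y∈ (suc i) (s<s i<n)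

  Cylinder-≤ : ∀ {m n y z} → m ≤ n → y ∈ Cylinder n z → y ∈ Cylinder m z
  Cylinder-≤ m≤n y∈ i i<m = y∈ i (≤-trans i<m m≤n)

  module _ (f : Simple) where

    private
      S = birkhoff (value f)
      L = window f
      M = bound f

    birkhoff-local : ∀ k {y z} → y ∈ Cylinder (k + L) z → S k y ≡ S k z
    birkhoff-local zero    y∈ = refl
    birkhoff-local (suc k) y∈ = cong₂ _+_ (local f (Cylinder-≤ (m≤n⇒m≤1+n (m≤n+m L k)) y∈)) (birkhoff-local k (shift-Cylinder y∈))

    birkhoff-cong : ∀ k {y z} → y ≗ z → S k y ≡ S k z
    birkhoff-cong k y≗z = birkhoff-local k (λ i _ → y≗z i)

    birkhoff-bounded : ∀ k z → S k z ≤ k * M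
    birkhoff-bounded zero    z = z≤n
    birkhoff-bounded (suc k) z = +-mono-≤ (bounded f z) (birkhoff-bounded k (shift z))

    -- Agreement on `k` letters determines the value of `f` at all but at most the last `L` of the
    -- `k` positions, and each of these contributes at most `M`.
    birkhoff-near : ∀ k {y z} → y ∈ Cylinder k z → S k y ≤ S k z + L * M
    birkhoff-near k {y} {z} y∈ with ≤-total k L
    ... | inj₁ k≤L = ≤-trans (birkhoff-bounded k y) (≤-trans (*-monoˡ-≤ M k≤L) (m≤n+m (L * M) (S k z)))
    birkhoff-near zero    {y} {z} y∈ | inj₂ _ = z≤n
    birkhoff-near (suc k) {y} {z} y∈ | inj₂ L≤k = begin
      value f y + S k (shift y)           ≤⟨ +-mono-≤ (≤-reflexive (local f (Cylinder-≤ L≤k y∈))) (birkhoff-near k (shift-Cylinder y∈)) ⟩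
      value f z + (S k (shift z) + L * M) ≡⟨ +-assoc (value f z) _ _ ⟨
      S (suc k) z + L * M                 ∎
      where open ≤-Reasoning

  count : Letter → List Letter → ℕ
  count c []       = 0
  count 0F (0F ∷ w) = suc (count 0F w)
  count 0F (1F ∷ w) = count 0F w
  count 1F (0F ∷ w) = count 1F w
  count 1F (1F ∷ w) = suc (count 1F w)

  -- `2≤zeros` makes the blocks of `0F` at least double in length at each level, `1≤zeros` keeps the
  -- blocks of `1F` nonempty, and `τ1≤τ0` keeps them no longer than those of `0F`. With
  -- `ones≤zeros`, at least half the length of each block then comes from blocks of `0F`.
  record Balanced (τ : Substitution) : Set where
    field
      2≤zeros    : 2 ≤ count 0F (toList (τ 0F))
      1≤zeros    : 1 ≤ count 0F (toList (τ 1F))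
      ones≤zeros : ∀ a → count 1F (toList (τ a)) ≤ count 0F (toList (τ a))
      τ1≤τ0      : ∀ c → count c (toList (τ 1F)) ≤ count c (toList (τ 0F))

  module Expansion (τ : ℕ → Substitution) where

    -- The composition of `τ 0`, ..., `τ (n - 1)`, with `τ (n - 1)` applied first; `size n w` is the
    -- length of the image of a finite word `w` under it. The images of single letters are the
    -- blocks of level `n`.
    expand : ℕ → Sequence → Sequence
    expand zero    u = u
    expand (suc n) u = expand n (apply (τ n) u)

    size : ℕ → List Letter → ℕ
    size zero    w = length w
    size (suc n) w = size n (image (τ n) w)

    expand-cong : ∀ n {u v} → u ≗ v → expand n u ≗ expand n v
    expand-cong zero    u≗v = u≗v
    expand-cong (suc n) u≗v = expand-cong n (apply-cong (τ n) u≗v)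

    size-++ : ∀ n v w → size n (v ++ w) ≡ size n v + size n w
    size-++ zero    v w = List.length-++ v
    size-++ (suc n) v w = trans (cong (size n) (List.concatMap-++ (toList ∘ τ n) v w)) (size-++ n (image (τ n) v) (image (τ n) w))

    expand-drop : ∀ n w u → drop (size n w) (expand n (w ++∞ u)) ≗ expand n u
    expand-drop zero    w u   = drop-++∞ w u
    expand-drop (suc n) w u k = trans
      (expand-cong n (apply-++∞ (τ n) w u) (size (suc n) w + k))
      (expand-drop n (image (τ n) w) (apply (τ n) u) k)

    expand-prefix : ∀ n w u v → expand n (w ++∞ u) ∈ Cylinder (size n w) (expand n (w ++∞ v))
    expand-prefix zero    w u v         = ++∞-prefix w u v
    expand-prefix (suc n) w u v i i<len = begin
      expand n (apply (τ n) (w ++∞ u)) i           ≡⟨ expand-cong n (apply-++∞ (τ n) w u) i ⟩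
      expand n (image (τ n) w ++∞ apply (τ n) u) i ≡⟨ expand-prefix n (image (τ n) w) (apply (τ n) u) (apply (τ n) v) i i<len ⟩
      expand n (image (τ n) w ++∞ apply (τ n) v) i ≡⟨ expand-cong n (apply-++∞ (τ n) w v) i ⟨
      expand n (apply (τ n) (w ++∞ v)) i           ∎
      where open ≡-Reasoning

    ℓ : ℕ → Letter → ℕ
    ℓ n a = size n (a ∷ [])

    ℓ-suc : ∀ n a → ℓ (suc n) a ≡ size n (toList (τ n a))
    ℓ-suc n a = cong (size n) (List.++-identityʳ (toList (τ n a)))

    size-[] : ∀ n → size n [] ≡ 0
    size-[] zero    = refl
    size-[] (suc n) = size-[] n

    size-count : ∀ n w → size n w ≡ count 0F w * ℓ n 0F + count 1F w * ℓ n 1F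
    size-count n []       = size-[] n
    size-count n (0F ∷ w) = trans (size-++ n (0F ∷ []) w) (trans (cong (ℓ n 0F +_) (size-count n w)) (sym (+-assoc (ℓ n 0F) _ _)))
    size-count n (1F ∷ w) = trans (size-++ n (1F ∷ []) w) (trans (cong (ℓ n 1F +_) (size-count n w))
      (solve 4 (λ z o a b → b :+ (z :* a :+ o :* b) := z :* a :+ (b :+ o :* b)) refl (count 0F w) (count 1F w) (ℓ n 0F) (ℓ n 1F)))
      where open +-*-Solver

    birkhoff-∷ : ∀ (f : Simple) n a w u → birkhoff (value f) (size n (a ∷ w)) (expand n (a ∷∞ w ++∞ u)) ≡
      birkhoff (value f) (ℓ n a) (expand n (a ∷∞ w ++∞ u)) + birkhoff (value f) (size n w) (expand n (w ++∞ u))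
    birkhoff-∷ f n a w u = begin
      S (size n (a ∷ w)) z                          ≡⟨ cong (λ k → S k z) (size-++ n (a ∷ []) w) ⟩
      S (ℓ n a + size n w) z                        ≡⟨ birkhoff-+ (value f) (ℓ n a) (size n w) z ⟩
      S (ℓ n a) z + S (size n w) (drop (ℓ n a) z)   ≡⟨ cong (S (ℓ n a) z +_) (birkhoff-cong f (size n w) (expand-drop n (a ∷ []) (w ++∞ u))) ⟩
      S (ℓ n a) z + S (size n w) (expand n (w ++∞ u)) ∎
      where
      open ≡-Reasoning
      S = birkhoff (value f)
      z = expand n (a ∷∞ w ++∞ u)

    module _ (balanced : ∀ n → Balanced (τ n)) where
      open module B n = Balanced (balanced n)

      ℓ₁≤ℓ₀ : ∀ n → ℓ n 1F ≤ ℓ n 0F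
      ℓ₁≤ℓ₀ zero    = ≤-refl
      ℓ₁≤ℓ₀ (suc n) = begin
        ℓ (suc n) 1F                                   ≡⟨ ℓ-suc n 1F ⟩
        size n t₁                                      ≡⟨ size-count n t₁ ⟩
        count 0F t₁ * ℓ n 0F + count 1F t₁ * ℓ n 1F    ≤⟨ +-mono-≤ (*-monoˡ-≤ (ℓ n 0F) (τ1≤τ0 n 0F)) (*-monoˡ-≤ (ℓ n 1F) (τ1≤τ0 n 1F)) ⟩
        count 0F t₀ * ℓ n 0F + count 1F t₀ * ℓ n 1F    ≡⟨ size-count n t₀ ⟨
        size n t₀                                      ≡⟨ ℓ-suc n 0F ⟨
        ℓ (suc n) 0F                                   ∎
        where
        open ≤-Reasoning
        t₀ = toList (τ n 0F)
        t₁ = toList (τ n 1F)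

      ℓ≤ℓ₀ : ∀ n a → ℓ n a ≤ ℓ n 0F
      ℓ≤ℓ₀ n 0F = ≤-refl
      ℓ≤ℓ₀ n 1F = ℓ₁≤ℓ₀ n

      zeros≤ℓ : ∀ n a → count 0F (toList (τ n a)) * ℓ n 0F ≤ ℓ (suc n) a
      zeros≤ℓ n a = ≤-trans (m≤m+n _ _) (≤-reflexive (sym (trans (ℓ-suc n a) (size-count n (toList (τ n a))))))

      2ℓ≤ℓ : ∀ n → 2 * ℓ n 0F ≤ ℓ (suc n) 0F
      2ℓ≤ℓ n = ≤-trans (*-monoˡ-≤ (ℓ n 0F) (2≤zeros n)) (zeros≤ℓ n 0F)

      1≤zeros-τ : ∀ n a → 1 ≤ count 0F (toList (τ n a))
      1≤zeros-τ n 0F = ≤-trans (s≤s z≤n) (2≤zeros n)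
      1≤zeros-τ n 1F = 1≤zeros n

      0<ℓ : ∀ n a → 0 < ℓ n a
      0<ℓ zero    a = z<s
      0<ℓ (suc n) a = ≤-trans (*-mono-≤ (1≤zeros-τ n a) (0<ℓ n 0F)) (zeros≤ℓ n a)

      -- The distance `s` from position `a` to the next block boundary is at most the length of a
      -- longest block. Moving one position forward either decreases `s` or enters a new block.
      next-block : ∀ n u a → ∃[ s ] ∃[ v ] (s ≤ ℓ n 0F × drop (a + s) (expand n u) ≗ expand n v)
      next-block n u zero = 0 , u , z≤n , λ _ → refl
      next-block n u (suc a) with next-block n u a
      ... | suc s , v , s≤ , eq = s , v , <⇒≤ s≤ , λ i → trans (cong (λ k → expand n u (k + i)) (sym (+-suc a s))) (eq i)
      -- Position `a` is itself a boundary, so the step enters the block of `v 0`, of which `m`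
      -- letters remain.
      ... | zero , v , _ , eq = m , shift v , ≤-trans pred[n]≤n (ℓ≤ℓ₀ n (v 0)) , λ i → begin
        expand n u (suc a + m + i)                 ≡⟨ cong (expand n u) (solve 3 (λ a m i → con 1 :+ a :+ m :+ i := a :+ con 0 :+ (con 1 :+ m :+ i)) refl a m i) ⟩
        expand n u (a + 0 + (suc m + i))           ≡⟨ eq (suc m + i) ⟩
        expand n v (suc m + i)                     ≡⟨ cong (λ k → expand n v (k + i)) (suc-pred (ℓ n (v 0)) {{>-nonZero (0<ℓ n (v 0))}}) ⟩
        expand n v (ℓ n (v 0) + i)                 ≡⟨ expand-cong n (∷∞-η v) (ℓ n (v 0) + i) ⟩
        expand n (v 0 ∷∞ shift v) (ℓ n (v 0) + i)  ≡⟨ expand-drop n (v 0 ∷ []) (shift v) i ⟩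
        expand n (shift v) i                       ∎
        where
        m = pred (ℓ n (v 0))
        open ≡-Reasoning
        open +-*-Solver

      -- Cuts the first `j` letters into whole blocks `w` and `t` letters of the incomplete block
      -- that follows.
      block-prefix : ∀ n v j → ∃[ w ] ∃[ u ] ∃[ t ] (v ≗ w ++∞ u × j ≡ size n w + t × t < ℓ n (u 0))
      block-prefix n v zero = [] , v , 0 , (λ _ → refl) , sym (trans (+-identityʳ _) (size-[] n)) , 0<ℓ n (v 0)
      block-prefix n v (suc j) with block-prefix n v j
      ... | w , u , t , v≗ , j≡ , t<ℓ with m≤n⇒m<n∨m≡n t<ℓ
      ...   | inj₁ 1+t<ℓ = w , u , suc t , v≗ , trans (cong suc j≡) (sym (+-suc _ t)) , 1+t<ℓ
      -- The new letter completes the block, which moves into `w`.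
      ...   | inj₂ 1+t≡ℓ = w ++ u 0 ∷ [] , shift u , 0 ,
        (λ i → trans (v≗ i) (trans (++∞-cong w (∷∞-η u) i) (sym (++∞-assoc w (u 0 ∷ []) (shift u) i)))) ,
        (begin
          suc j                           ≡⟨ cong suc j≡ ⟩
          suc (size n w + t)              ≡⟨ +-suc (size n w) t ⟨
          size n w + suc t                ≡⟨ cong (size n w +_) 1+t≡ℓ ⟩
          size n w + ℓ n (u 0)            ≡⟨ size-++ n w (u 0 ∷ []) ⟨
          size n (w ++ u 0 ∷ [])          ≡⟨ +-identityʳ _ ⟨
          size n (w ++ u 0 ∷ []) + 0      ∎) ,
        0<ℓ n (u 1)
        where open ≡-Reasoning

    expand-limit : ∀ {ω} → ((Ω , _) : IsLimitWord τ ω) → ∀ n → ω ≗ expand n (Ω n)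
    expand-limit (Ω , Ω0≗ω , Ω≗) zero    k = sym (Ω0≗ω k)
    expand-limit L@(Ω , Ω0≗ω , Ω≗) (suc n) k = trans (expand-limit L n k) (expand-cong n (Ω≗ n) k)

open Words

-- Convergence of averages

module Rates (em : ExcludedMiddle 0ℓ) (ℝ : CompleteOrderedField) where
  open OrderedField em ℝ

  -- A sum `s` of `k` values has average between `α` and `β`, up to an error `C / k`; multiplying by
  -- `k` includes the case `k = 0`.
  record WithinRates (α β C : Carrier) (k s : ℕ) : Set where
    constructor _,_
    field
      lower : fromℕ k * α ≤ fromℕ s + C
      upper : fromℕ s ≤ fromℕ k * β + C
  open WithinRates

  -- The constant `C` serves all starting positions `a` and all lengths `k` at once; this uniformity
  -- later carries the bounds over to every point of the orbit closure.
  LowerRate UpperRate : Sequence → Simple → Carrier → Set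
  LowerRate ω f α = ∃[ C ] ∀ a k → fromℕ k * α ≤ fromℕ (birkhoff (value f) k (drop a ω)) + C
  UpperRate ω f β = ∃[ C ] ∀ a k → fromℕ (birkhoff (value f) k (drop a ω)) ≤ fromℕ k * β + C

  HasUniformRates : Sequence → Set
  HasUniformRates ω = ∀ f ε → 0# < ε → ∃[ α ] ∃[ β ] (LowerRate ω f α × UpperRate ω f β × β ≤ α + ε)

  within-+ : ∀ {α β C D i j s t} → WithinRates α β C i s → WithinRates α β D j t →
             WithinRates α β (C + D) (i ℕ.+ j) (s ℕ.+ t)
  within-+ {α} {β} {C} {D} {i} {j} {s} {t} (lo , hi) (lo′ , hi′) = (begin
      fromℕ (i ℕ.+ j) * α                 ≈⟨ split i j α ⟩
      fromℕ i * α + fromℕ j * α           ≤⟨ +-mono-≤ lo lo′ ⟩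
      (fromℕ s + C) + (fromℕ t + D)       ≈⟨ swap (fromℕ s) (fromℕ t) ⟩
      (fromℕ s + fromℕ t) + (C + D)       ≈⟨ +-congʳ (fromℕ-+ s t) ⟨
      fromℕ (s ℕ.+ t) + (C + D)           ∎) , (begin
      fromℕ (s ℕ.+ t)                       ≈⟨ fromℕ-+ s t ⟩
      fromℕ s + fromℕ t                     ≤⟨ +-mono-≤ hi hi′ ⟩
      (fromℕ i * β + C) + (fromℕ j * β + D) ≈⟨ swap (fromℕ i * β) (fromℕ j * β) ⟩
      (fromℕ i * β + fromℕ j * β) + (C + D) ≈⟨ +-congʳ (split i j β) ⟨
      fromℕ (i ℕ.+ j) * β + (C + D)         ∎)
    where
    open ≤-Reasoning
    split : ∀ i j x → fromℕ (i ℕ.+ j) * x ≈ fromℕ i * x + fromℕ j * x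
    split i j x = trans (*-congʳ (fromℕ-+ i j)) (distribʳ _ _ _)
    swap : ∀ x y → (x + C) + (y + D) ≈ (x + y) + (C + D)
    swap x y = solve 4 (λ x y c d → (x :+ c) :+ (y :+ d) := (x :+ y) :+ (c :+ d)) refl x y C D

  within-weaken : ∀ {α β C D k s} → C ≤ D → WithinRates α β C k s → WithinRates α β D k s
  within-weaken C≤D (lo , hi) = ≤-trans lo (+-monoʳ-≤ _ C≤D) , ≤-trans hi (+-monoʳ-≤ _ C≤D)

  short-multiple : ∀ x Λ → ∃[ K ] (0# ≤ K × (∀ t → t ℕ.≤ Λ → fromℕ t * x ≤ K))
  short-multiple x Λ with ≤-total 0# x
  ... | inj₁ 0≤x = fromℕ Λ * x , *-nonNeg (0≤fromℕ Λ) 0≤x , λ t t≤Λ → *-monoʳ-≤ 0≤x (fromℕ-mono-≤ t≤Λ)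
  ... | inj₂ x≤0 = 0# , ≤-refl , λ t _ → ≤-respʳ-≈ (zeroʳ _) (*-monoˡ-≤ (0≤fromℕ t) x≤0)

  -- For segments of bounded length any rates hold once the constant is large enough. This takes
  -- care of the incomplete blocks at both ends of an orbit segment.
  within-short : ∀ α β M Λ → ∃[ K ] (0# ≤ K × (∀ t s → t ℕ.≤ Λ → s ℕ.≤ t ℕ.* M → WithinRates α β K t s))
  within-short α β M Λ =
    let K₁ , 0≤K₁ , bound₁ = short-multiple α Λ
        -- A sum of `t` values up to `M` exceeds `t` times `β` by at most `t` times `M - β`, which
        -- may have either sign.
        K₂ , 0≤K₂ , bound₂ = short-multiple (fromℕ M - β) Λ
    in K₁ + K₂ , nonNeg 0≤K₁ 0≤K₂ , λ t s t≤Λ s≤tM →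
      lower-short {t} {s} 0≤K₂ (bound₁ t t≤Λ) , upper-short {t} {s} 0≤K₁ (bound₂ t t≤Λ) (≤-respʳ-≈ (fromℕ-* t M) (fromℕ-mono-≤ s≤tM))
    where
    nonNeg : ∀ {x y} → 0# ≤ x → 0# ≤ y → 0# ≤ x + y
    nonNeg 0≤x 0≤y = ≤-respˡ-≈ (+-identityˡ 0#) (+-mono-≤ 0≤x 0≤y)
    lower-short : ∀ {t s K₁ K₂} → 0# ≤ K₂ → fromℕ t * α ≤ K₁ → fromℕ t * α ≤ fromℕ s + (K₁ + K₂)
    lower-short {t} {s} {K₁} {K₂} 0≤K₂ le = linear (+-mono-≤ (+-mono-≤ le 0≤K₂) (0≤fromℕ s))
      (solve 4 (λ x s k₁ k₂ → s :+ (k₁ :+ k₂) :- x := (k₁ :+ k₂) :+ s :- ((x :+ con (ℤ.+ 0)) :+ con (ℤ.+ 0))) refl (fromℕ t * α) (fromℕ s) K₁ K₂)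
    upper-short : ∀ {t s K₁ K₂} → 0# ≤ K₁ → fromℕ t * (fromℕ M - β) ≤ K₂ → fromℕ s ≤ fromℕ t * fromℕ M → fromℕ s ≤ fromℕ t * β + (K₁ + K₂)
    upper-short {t} {s} {K₁} {K₂} 0≤K₁ le s≤ = linear (+-mono-≤ (+-mono-≤ le 0≤K₁) s≤)
      (solve 6 (λ t m b s k₁ k₂ → t :* b :+ (k₁ :+ k₂) :- s := (k₂ :+ k₁) :+ t :* m :- ((t :* (m :- b) :+ con (ℤ.+ 0)) :+ s)) refl (fromℕ t) (fromℕ M) β (fromℕ s) K₁ K₂)

  -- With γ = g + g the average over a long 0-block and β = b + b a bound for all
  -- averages, a word with at least half of its weight on 0-blocks has average
  -- at most (γ + β) / 2 + δ.
  upper-average : ∀ {z o l₀ l₁ g b δ D s} → 0# ≤ z → 0# ≤ o → 0# ≤ l₁ → 0# ≤ δ → o * l₁ ≤ z * l₀ → D ≤ l₀ * δ → g ≤ b →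
    s ≤ z * (l₀ * (g + g) + D) + o * (l₁ * (b + b)) → s ≤ (z * l₀ + o * l₁) * (g + b + δ)
  upper-average {z} {o} {l₀} {l₁} {g} {b} {δ} {D} {s} 0≤z 0≤o 0≤l₁ 0≤δ ol≤zl D≤ g≤b s≤ =
    linear (+-mono-≤ (+-mono-≤ (+-mono-≤ s≤
        (*-nonNeg (x≤y⇒0≤y-x g≤b) (x≤y⇒0≤y-x ol≤zl)))
        (*-nonNeg 0≤z (x≤y⇒0≤y-x D≤)))
        (*-nonNeg (*-nonNeg 0≤o 0≤l₁) 0≤δ))
      (solve 9 (λ z o l₀ l₁ g b δ D s → (z :* l₀ :+ o :* l₁) :* (g :+ b :+ δ) :- s :=
        (z :* (l₀ :* (g :+ g) :+ D) :+ o :* (l₁ :* (b :+ b)) :+ (b :- g) :* (z :* l₀ :- o :* l₁) :+ z :* (l₀ :* δ :- D) :+ o :* l₁ :* δ)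
        :- (s :+ con (ℤ.+ 0) :+ con (ℤ.+ 0) :+ con (ℤ.+ 0))) refl z o l₀ l₁ g b δ D s)

  -- The mirror image of `upper-average`, with `a + a` a lower bound for all averages. The
  -- difference of the two sides is the slack of the last hypothesis plus three nonnegative
  -- products.
  lower-average : ∀ {z o l₀ l₁ g a δ D s} → 0# ≤ z → 0# ≤ o → 0# ≤ l₁ → 0# ≤ δ → o * l₁ ≤ z * l₀ → D ≤ l₀ * δ → a ≤ g →
    z * (l₀ * (g + g)) + o * (l₁ * (a + a)) ≤ s + z * D → (z * l₀ + o * l₁) * (g + a - δ) ≤ s
  lower-average {z} {o} {l₀} {l₁} {g} {a} {δ} {D} {s} 0≤z 0≤o 0≤l₁ 0≤δ ol≤zl D≤ a≤g ≤s =
    linear (+-mono-≤ (+-mono-≤ (+-mono-≤ ≤s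
        (*-nonNeg (x≤y⇒0≤y-x a≤g) (x≤y⇒0≤y-x ol≤zl)))
        (*-nonNeg 0≤z (x≤y⇒0≤y-x D≤)))
        (*-nonNeg (*-nonNeg 0≤o 0≤l₁) 0≤δ))
      (solve 9 (λ z o l₀ l₁ g a δ D s → s :- (z :* l₀ :+ o :* l₁) :* (g :+ a :- δ) :=
        (s :+ z :* D :+ (g :- a) :* (z :* l₀ :- o :* l₁) :+ z :* (l₀ :* δ :- D) :+ o :* l₁ :* δ)
        :- (z :* (l₀ :* (g :+ g)) :+ o :* (l₁ :* (a :+ a)) :+ con (ℤ.+ 0) :+ con (ℤ.+ 0) :+ con (ℤ.+ 0))) refl z o l₀ l₁ g a δ D s)

  module _ {τ : ℕ → Substitution} (balanced : ∀ n → Balanced (τ n)) (f : Simple) where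
    open Expansion τ

    private
      S = birkhoff (value f)
      M = bound f
      D = window f ℕ.* M

    -- The error term is 0, so the bounds add up over any number of blocks. The continuation `u`
    -- matters because the window of `f` may reach beyond the block.
    BlockBounds : ℕ → Carrier → Carrier → Set
    BlockBounds n α β = ∀ a u → WithinRates α β 0# (ℓ n a) (S (ℓ n a) (expand n (a ∷∞ u)))

    word-bounds : ∀ {n α β} → BlockBounds n α β → ∀ w u → WithinRates α β 0# (size n w) (S (size n w) (expand n (w ++∞ u)))
    word-bounds {n} {α} {β} bounds [] u = ≡.subst (λ k → WithinRates α β 0# k (S k (expand n u))) (≡.sym (size-[] n))
      (≤-reflexive (trans (zeroˡ α) (sym (+-identityʳ _))) , ≤-reflexive (sym (trans (+-identityʳ _) (zeroˡ β))))
    word-bounds {n} {α} {β} bounds (a ∷ w) u = ≡.subst₂ (WithinRates α β 0#) (≡.sym (size-++ n (a ∷ []) w)) (≡.sym (birkhoff-∷ f n a w u))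
      (within-weaken {k = ℓ n a ℕ.+ size n w} (≤-reflexive (+-identityˡ 0#))
        (within-+ {i = ℓ n a} {size n w} (bounds a (w ++∞ u)) (word-bounds {n} bounds w u)))

    -- Blocks of `0F` at least double in length at each level, so their length is at least `2ⁿ`.
    1≤ℓ*½^ : ∀ n → 1# ≤ fromℕ (ℓ n 0F) * ½^ n
    1≤ℓ*½^ zero    = ≤-reflexive (sym (trans (*-identityʳ _) fromℕ-1))
    1≤ℓ*½^ (suc n) = begin
      1#                                       ≤⟨ 1≤ℓ*½^ n ⟩
      fromℕ l * p                              ≈⟨ ½-double _ ⟨
      ½ * (fromℕ l * p) + ½ * (fromℕ l * p)    ≈⟨ solve 3 (λ h l p → h :* (l :* p) :+ h :* (l :* p) := (l :+ (l :+ con (ℤ.+ 0))) :* (h :* p)) refl ½ (fromℕ l) p ⟩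
      (fromℕ l + (fromℕ l + 0#)) * (½ * p)     ≈⟨ *-congʳ (trans (fromℕ-+ l (l ℕ.+ 0)) (+-congˡ (fromℕ-+ l 0))) ⟨
      fromℕ (2 ℕ.* l) * (½ * p)                ≤⟨ *-monoʳ-≤ (proj₁ (0<½^ (suc n))) (fromℕ-mono-≤ (2ℓ≤ℓ balanced n)) ⟩
      fromℕ (ℓ (suc n) 0F) * ½^ suc n          ∎
      where
      open ≤-Reasoning
      l = ℓ n 0F
      p = ½^ n

    module _ {n α β} (bounds : BlockBounds n α β) where
      private
        -- An arbitrary continuation, which fixes the reference sum `c` over a block of `0F`.
        0∞ : Sequence
        0∞ _ = 0F
        l₀ = fromℕ (ℓ n 0F)
        l₁ = fromℕ (ℓ n 1F)
        c  = S (ℓ n 0F) (expand n (0F ∷∞ 0∞))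

      -- All occurrences of the block 0F carry almost the same sum c.
      word-average : ∀ w u → let s = fromℕ (S (size n w) (expand n (w ++∞ u)))
                                 z = fromℕ (count 0F w)
                                 o = fromℕ (count 1F w) in
        z * fromℕ c + o * (l₁ * α) ≤ s + z * fromℕ D × s ≤ z * (fromℕ c + fromℕ D) + o * (l₁ * β)
      word-average [] u rewrite size-[] n =
        ≤-reflexive (solve 3 (λ a b d → con (ℤ.+ 0) :* a :+ con (ℤ.+ 0) :* b := con (ℤ.+ 0) :+ con (ℤ.+ 0) :* d) refl (fromℕ c) (l₁ * α) (fromℕ D)) ,
        ≤-reflexive (solve 2 (λ a b → con (ℤ.+ 0) := con (ℤ.+ 0) :* a :+ con (ℤ.+ 0) :* b) refl (fromℕ c + fromℕ D) (l₁ * β))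
      word-average (a ∷ w) u rewrite birkhoff-∷ f n a w u = step a (word-average w u)
        where
        s = S (size n w) (expand n (w ++∞ u))
        z = fromℕ (count 0F w)
        o = fromℕ (count 1F w)
        step : ∀ a → z * fromℕ c + o * (l₁ * α) ≤ fromℕ s + z * fromℕ D × fromℕ s ≤ z * (fromℕ c + fromℕ D) + o * (l₁ * β) →
          let b = S (ℓ n a) (expand n (a ∷∞ w ++∞ u)) in
          fromℕ (count 0F (a ∷ w)) * fromℕ c + fromℕ (count 1F (a ∷ w)) * (l₁ * α) ≤ fromℕ (b ℕ.+ s) + fromℕ (count 0F (a ∷ w)) * fromℕ D ×
          fromℕ (b ℕ.+ s) ≤ fromℕ (count 0F (a ∷ w)) * (fromℕ c + fromℕ D) + fromℕ (count 1F (a ∷ w)) * (l₁ * β)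
        step 0F (lo , hi) =
          linear (+-mono-≤ lo c≤)
            (trans (+-congʳ (+-congʳ (fromℕ-+ b s))) (solve 6 (λ z c d x b s → b :+ s :+ (𝟙 :+ z) :* d :- ((𝟙 :+ z) :* c :+ x) := s :+ z :* d :+ (b :+ d) :- (z :* c :+ x :+ c)) refl z (fromℕ c) (fromℕ D) (o * (l₁ * α)) (fromℕ b) (fromℕ s))) ,
          linear (+-mono-≤ hi b≤)
            (trans (+-congˡ (-‿cong (fromℕ-+ b s))) (solve 6 (λ z c d x b s → (𝟙 :+ z) :* (c :+ d) :+ x :- (b :+ s) := z :* (c :+ d) :+ x :+ (c :+ d) :- (s :+ b)) refl z (fromℕ c) (fromℕ D) (o * (l₁ * β)) (fromℕ b) (fromℕ s)))
          where
          b = S (ℓ n 0F) (expand n (0F ∷∞ w ++∞ u))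
          c≤ : fromℕ c ≤ fromℕ b + fromℕ D
          c≤ = ≤-respʳ-≈ (fromℕ-+ b D) (fromℕ-mono-≤ (birkhoff-near f (ℓ n 0F) (expand-prefix n (0F ∷ []) 0∞ (w ++∞ u))))
          b≤ : fromℕ b ≤ fromℕ c + fromℕ D
          b≤ = ≤-respʳ-≈ (fromℕ-+ c D) (fromℕ-mono-≤ (birkhoff-near f (ℓ n 0F) (expand-prefix n (0F ∷ []) (w ++∞ u) 0∞)))
        step 1F (lo , hi) =
          linear (+-mono-≤ lo (lower (bounds 1F (w ++∞ u))))
            (trans (+-congʳ (+-congʳ (fromℕ-+ b s))) (solve 6 (λ x y o l b s → b :+ s :+ y :- (x :+ (𝟙 :+ o) :* l) := s :+ y :+ (b :+ con (ℤ.+ 0)) :- (x :+ o :* l :+ l)) refl (z * fromℕ c) (z * fromℕ D) o (l₁ * α) (fromℕ b) (fromℕ s))) ,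
          linear (+-mono-≤ hi (upper (bounds 1F (w ++∞ u))))
            (trans (+-congˡ (-‿cong (fromℕ-+ b s))) (solve 5 (λ x o l b s → x :+ (𝟙 :+ o) :* l :- (b :+ s) := x :+ o :* l :+ (l :+ con (ℤ.+ 0)) :- (s :+ b)) refl (z * (fromℕ c + fromℕ D)) o (l₁ * β) (fromℕ b) (fromℕ s)))
          where b = S (ℓ n 1F) (expand n (1F ∷∞ w ++∞ u))

      -- The new bounds are the midpoints between the reference average `γ` and the old bounds,
      -- widened by `δ`. As `γ` enters both, it cancels from their difference.
      contract : ∃[ α′ ] ∃[ β′ ] (BlockBounds (suc n) α′ β′ × β′ - α′ ≈ ½ * (β - α) + (fromℕ D * ½^ n + fromℕ D * ½^ n))
      contract = g + a - δ , g + b + δ , contracted ,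
        solve 5 (λ g h β α δ → g :+ h :* β :+ δ :- (g :+ h :* α :- δ) := h :* (β :- α) :+ (δ :+ δ)) refl g ½ β α δ
        where
        -- Changing the continuation changes the sum over a block of `0F` by at most `D`; spread
        -- over at least `2ⁿ` letters this is at most `δ` per letter.
        δ = fromℕ D * ½^ n
        a = ½ * α
        b = ½ * β
        γ = l₀ ⁻¹ * fromℕ c
        g = ½ * γ
        0<l₀ : 0# < l₀
        0<l₀ = ≡.subst (λ l → 0# < fromℕ l) (ℕ.suc-pred (ℓ n 0F) {{ℕ.>-nonZero (0<ℓ balanced n 0F)}}) (0<fromℕ-suc (ℕ.pred (ℓ n 0F)))
        l₀γ≈c : l₀ * γ ≈ fromℕ c
        l₀γ≈c = trans (sym (*-assoc _ _ _)) (trans (*-congʳ (⁻¹-inverseʳ 0<l₀)) (*-identityˡ _))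
        α≤γ : α ≤ γ
        α≤γ = *-cancelˡ-≤ 0<l₀ (≤-respʳ-≈ (trans (+-identityʳ _) (sym l₀γ≈c)) (lower (bounds 0F 0∞)))
        γ≤β : γ ≤ β
        γ≤β = *-cancelˡ-≤ 0<l₀ (≤-respˡ-≈ (sym l₀γ≈c) (≤-respʳ-≈ (+-identityʳ _) (upper (bounds 0F 0∞))))
        0≤δ : 0# ≤ δ
        0≤δ = *-nonNeg (0≤fromℕ D) (proj₁ (0<½^ n))
        D≤l₀δ : fromℕ D ≤ l₀ * δ
        D≤l₀δ = ≤-respˡ-≈ (*-identityʳ _) (≤-respʳ-≈ (solve 3 (λ d l p → d :* (l :* p) := l :* (d :* p)) refl (fromℕ D) l₀ (½^ n)) (*-monoˡ-≤ (0≤fromℕ D) (1≤ℓ*½^ n)))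

        word : ∀ w u → count 1F w ℕ.≤ count 0F w → WithinRates (g + a - δ) (g + b + δ) 0# (size n w) (S (size n w) (expand n (w ++∞ u)))
        word w u o≤z =
          ≤-respʳ-≈ (sym (+-identityʳ _)) (≤-respˡ-≈ (*-congʳ (sym size≈))
            (lower-average (0≤fromℕ (count 0F w)) (0≤fromℕ (count 1F w)) (0≤fromℕ (ℓ n 1F)) 0≤δ weight D≤l₀δ (*-monoˡ-≤ (proj₁ 0<½) α≤γ)
              (≤-respˡ-≈ (+-cong (*-congˡ (sym (trans (*-congˡ (½-double γ)) l₀γ≈c))) (*-congˡ (*-congˡ (sym (½-double α))))) (proj₁ (word-average w u))))) ,
          ≤-respʳ-≈ (sym (+-identityʳ _)) (≤-respʳ-≈ (*-congʳ (sym size≈))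
            (upper-average (0≤fromℕ (count 0F w)) (0≤fromℕ (count 1F w)) (0≤fromℕ (ℓ n 1F)) 0≤δ weight D≤l₀δ (*-monoˡ-≤ (proj₁ 0<½) γ≤β)
              (≤-respʳ-≈ (+-cong (*-congˡ (+-congʳ (sym (trans (*-congˡ (½-double γ)) l₀γ≈c)))) (*-congˡ (*-congˡ (sym (½-double β))))) (proj₂ (word-average w u)))))
          where
          size≈ : fromℕ (size n w) ≈ fromℕ (count 0F w) * l₀ + fromℕ (count 1F w) * l₁
          size≈ = trans (reflexive (≡.cong fromℕ (size-count n w))) (trans (fromℕ-+ (count 0F w ℕ.* ℓ n 0F) _)
            (+-cong (fromℕ-* (count 0F w) (ℓ n 0F)) (fromℕ-* (count 1F w) (ℓ n 1F))))
          weight : fromℕ (count 1F w) * l₁ ≤ fromℕ (count 0F w) * l₀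
          weight = ≤-respˡ-≈ (fromℕ-* (count 1F w) (ℓ n 1F)) (≤-respʳ-≈ (fromℕ-* (count 0F w) (ℓ n 0F))
            (fromℕ-mono-≤ (ℕ.*-mono-≤ o≤z (ℓ₁≤ℓ₀ balanced n))))

        contracted : BlockBounds (suc n) (g + a - δ) (g + b + δ)
        contracted x u = ≡.subst₂ (WithinRates (g + a - δ) (g + b + δ) 0#) (≡.sym (ℓ-suc n x))
          (≡.trans (birkhoff-cong f (size n w) (λ i → ≡.sym (expand-cong n unfold i))) (≡.cong (λ k → S k (expand (suc n) (x ∷∞ u))) (≡.sym (ℓ-suc n x))))
          (word w (apply (τ n) u) (Balanced.ones≤zeros (balanced n) x))
          where
          w = toList (τ n x)
          unfold : apply (τ n) (x ∷∞ u) ≗ w ++∞ apply (τ n) u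
          unfold i = ≡.trans (apply-++∞ (τ n) (x ∷ []) u i) (≡.cong (λ v → (v ++∞ apply (τ n) u) i) (List.++-identityʳ w))

    private
      -- The error of two `δ` at level `n` equals `4D` times `½^ suc n`, so every level adds the
      -- same multiple of the current power of ½.
      4D = fromℕ D + fromℕ D + (fromℕ D + fromℕ D)
      B  = fromℕ M + 4D

    -- The width is halved at every step and increases by `4D * ½^ suc n`; hence it is at most a
    -- linear function of `n` times `½^ n`. At level 0 the trivial bounds 0 and `M` are taken.
    block-bounds : ∀ n → ∃[ α ] ∃[ β ] (BlockBounds n α β × β - α ≤ B * fromℕ (suc n) * ½^ n)
    block-bounds zero = 0# , fromℕ M , (λ a u →
        ≤-respˡ-≈ (sym (zeroʳ _)) (≤-respʳ-≈ (sym (+-identityʳ _)) (0≤fromℕ (S 1 (a ∷∞ u)))) ,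
        ≤-respʳ-≈ (trans (fromℕ-* 1 M) (sym (+-identityʳ _))) (fromℕ-mono-≤ (birkhoff-bounded f 1 (a ∷∞ u)))) ,
      ≤-respʳ-≈ (sym (trans (*-identityʳ _) (trans (*-congˡ fromℕ-1) (*-identityʳ _))))
        (linear (+-mono-≤ (+-mono-≤ 0≤D 0≤D) (+-mono-≤ 0≤D 0≤D))
          (solve 2 (λ m d → m :+ (d :+ d :+ (d :+ d)) :- (m :- con (ℤ.+ 0)) := d :+ d :+ (d :+ d) :- (con (ℤ.+ 0) :+ con (ℤ.+ 0) :+ (con (ℤ.+ 0) :+ con (ℤ.+ 0)))) refl (fromℕ M) (fromℕ D)))
      where 0≤D = 0≤fromℕ D
    block-bounds (suc n) =
      let α , β , bounds , width = block-bounds n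
          α′ , β′ , bounds′ , width′ = contract {n} bounds
      in α′ , β′ , bounds′ , ≤-respˡ-≈ (sym width′) (narrow α β width)
      where
      p = ½^ n
      m = fromℕ (suc n)
      d = fromℕ D
      narrow : ∀ α β → β - α ≤ B * m * p → ½ * (β - α) + (d * p + d * p) ≤ B * (1# + m) * (½ * p)
      narrow α β width = begin
        ½ * (β - α) + (d * p + d * p)                       ≤⟨ +-mono-≤ (*-monoˡ-≤ (proj₁ 0<½) width) (≤-reflexive (trans (sym (½-double _)) (solve 3 (λ h d p → h :* (d :* p :+ d :* p) :+ h :* (d :* p :+ d :* p) := (d :+ d :+ (d :+ d)) :* (h :* p)) refl ½ d p))) ⟩
        ½ * (B * m * p) + 4D * (½ * p)                      ≤⟨ linear (*-nonNeg (0≤fromℕ M) (proj₁ (0<½^ (suc n))))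
          (solve 5 (λ M D m h p → (M :+ D) :* (𝟙 :+ m) :* (h :* p) :- (h :* ((M :+ D) :* m :* p) :+ D :* (h :* p)) := M :* (h :* p) :- con (ℤ.+ 0)) refl (fromℕ M) 4D m ½ p) ⟩
        B * (1# + m) * (½ * p)                              ∎
        where open ≤-Reasoning

    module _ {ω} (limit : IsLimitWord τ ω) where
      -- An orbit segment that reaches the next block boundary consists of an incomplete block,
      -- whole blocks and another incomplete block. The whole blocks satisfy the bounds exactly, and
      -- each end costs at most `K`; a shorter segment costs `K` only once.
      block-rates : ∀ {n α β} → BlockBounds n α β → LowerRate ω f α × UpperRate ω f β
      block-rates {n} {α} {β} bounds = (C , λ a k → lower (bound-at a k)) , (C , λ a k → upper (bound-at a k))
        where
        Ω = proj₁ limit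
        short = within-short α β M (ℓ n 0F)
        K = proj₁ short
        0≤K = proj₁ (proj₂ short)
        within-K = proj₂ (proj₂ short)
        C = K + (0# + K)
        K≤C : K ≤ C
        K≤C = linear 0≤K (solve 1 (λ k → k :+ (con (ℤ.+ 0) :+ k) :- k := k :- con (ℤ.+ 0)) refl K)

        bound-expand : ∀ v j → WithinRates α β (0# + K) j (S j (expand n v))
        bound-expand v j = let w , u , t , v≗ , j≡ , t<ℓ = block-prefix balanced n v j in go w u t v≗ j≡ t<ℓ
          where
          go : ∀ w u t → v ≗ w ++∞ u → j ≡ size n w ℕ.+ t → t ℕ.< ℓ n (u 0) → WithinRates α β (0# + K) j (S j (expand n v))
          go w u t v≗ ≡.refl t<ℓ = ≡.subst (WithinRates α β (0# + K) j) (≡.sym S≡)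
            (within-+ {i = size n w} {t} (word-bounds {n} bounds w u)
              (within-K t _ (ℕ.≤-trans (ℕ.<⇒≤ t<ℓ) (ℓ≤ℓ₀ balanced n (u 0))) (birkhoff-bounded f t (drop (size n w) (expand n v)))))
            where
            S≡ : S j (expand n v) ≡ S (size n w) (expand n (w ++∞ u)) ℕ.+ S t (drop (size n w) (expand n v))
            S≡ = ≡.trans (birkhoff-+ (value f) (size n w) t (expand n v)) (≡.cong (ℕ._+ S t (drop (size n w) (expand n v))) (birkhoff-cong f (size n w) (expand-cong n v≗)))

        bound-at : ∀ a k → WithinRates α β C k (S k (drop a ω))
        bound-at a k = let s , v , s≤ , eq = next-block balanced n (Ω n) a in go s v s≤ eq
          where
          go : ∀ s v → s ℕ.≤ ℓ n 0F → drop (a ℕ.+ s) (expand n (Ω n)) ≗ expand n v → WithinRates α β C k (S k (drop a ω))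
          go s v s≤ eq with ℕ.≤-total k s
          ... | inj₁ k≤s = within-weaken {k = k} K≤C (within-K k _ (ℕ.≤-trans k≤s s≤) (birkhoff-bounded f k (drop a ω)))
          ... | inj₂ s≤k = ≡.subst₂ (WithinRates α β C) (ℕ.m+[n∸m]≡n s≤k) S≡
            (within-+ {i = s} {k ℕ.∸ s} (within-K s _ s≤ (birkhoff-bounded f s (drop a ω))) (bound-expand v (k ℕ.∸ s)))
            where
            tail : drop s (drop a ω) ≗ expand n v
            tail i = ≡.trans (≡.cong ω (≡.sym (ℕ.+-assoc a s i))) (≡.trans (expand-limit limit n (a ℕ.+ s ℕ.+ i)) (eq i))
            S≡ : S s (drop a ω) ℕ.+ S (k ℕ.∸ s) (expand n v) ≡ S k (drop a ω)
            S≡ = ≡.trans (≡.cong (S s (drop a ω) ℕ.+_) (birkhoff-cong f (k ℕ.∸ s) (λ i → ≡.sym (tail i))))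
              (≡.trans (≡.sym (birkhoff-+ (value f) s (k ℕ.∸ s) (drop a ω))) (≡.cong (λ j → S j (drop a ω)) (ℕ.m+[n∸m]≡n s≤k)))

      converging-rates : ∀ ε → 0# < ε → ∃[ α ] ∃[ β ] (LowerRate ω f α × UpperRate ω f β × β ≤ α + ε)
      converging-rates ε 0<ε =
        let n , small = ½^-linear-small B 0≤B 0<ε
            α , β , bounds , width = block-bounds n
            lo , hi = block-rates {n} bounds
        in α , β , lo , hi , linear (≤-trans width small) (solve 3 (λ a b e → a :+ e :- b := e :- (b :- a)) refl α β ε)
        where
        0≤D = 0≤fromℕ D
        0≤B : 0# ≤ B
        0≤B = ≤-respˡ-≈ (solve 0 (o :+ (o :+ o :+ (o :+ o)) := o) refl) (+-mono-≤ (0≤fromℕ M) (+-mono-≤ (+-mono-≤ 0≤D 0≤D) (+-mono-≤ 0≤D 0≤D)))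
          where
          o : Polynomial 0
          o = con (ℤ.+ 0)

  uniform-rates : ∀ {τ ω} → (∀ n → Balanced (τ n)) → IsLimitWord τ ω → HasUniformRates ω
  uniform-rates balanced limit f = converging-rates balanced f limit

-- Operations on locally constant functions.

record Clopen : Set where
  field
    χ      : Sequence → Bool
    window : ℕ
    local  : ∀ {y z} → y ∈ Cylinder window z → χ y ≡ χ z

∁ᶜ : Clopen → Clopen
∁ᶜ C = record { χ = not ∘ Clopen.χ C ; window = Clopen.window C ; local = ≡.cong not ∘ Clopen.local C }

infixl 6 _⊕_

constant : ℕ → Simple
constant c = record { value = λ _ → c ; window = 0 ; bound = c ; local = λ _ → ≡.refl ; bounded = λ _ → ℕ.≤-refl }

_⊕_ : Simple → Simple → Simple
f ⊕ g = record
  { value   = λ z → value f z ℕ.+ value g z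
  ; window  = window f ℕ.+ window g
  ; bound   = bound f ℕ.+ bound g
  ; local   = λ y∈ → ≡.cong₂ ℕ._+_ (local f (Cylinder-≤ (ℕ.m≤m+n _ _) y∈)) (local g (Cylinder-≤ (ℕ.m≤n+m _ _) y∈))
  ; bounded = λ z → ℕ.+-mono-≤ (bounded f z) (bounded g z)
  }

restrict : Simple → Clopen → Simple
restrict f C = record
  { value   = λ z → if χ C z then value f z else 0
  ; window  = window f ℕ.+ Clopen.window C
  ; bound   = bound f
  ; local   = λ y∈ → ≡.cong₂ (λ b k → if b then k else 0)
                (Clopen.local C (Cylinder-≤ (ℕ.m≤n+m _ _) y∈)) (local f (Cylinder-≤ (ℕ.m≤m+n _ _) y∈))
  ; bounded = λ z → bound-if (χ C z) (bounded f z)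
  }
  where
  open Clopen using (χ)
  bound-if : ∀ b {m n} → m ℕ.≤ n → (if b then m else 0) ℕ.≤ n
  bound-if false m≤n = z≤n
  bound-if true  m≤n = m≤n

shifted : Simple → Simple
shifted f = record
  { value   = value f ∘ shift
  ; window  = suc (window f)
  ; bound   = bound f
  ; local   = local f ∘ shift-Cylinder
  ; bounded = bounded f ∘ shift
  }

total : (ℕ → Simple) → ℕ → Simple
total F zero    = constant 0
total F (suc n) = F 0 ⊕ total (F ∘ suc) n

infix 4 _≤ˢ_

_≤ˢ_ : Simple → Simple → Set
f ≤ˢ g = ∀ z → value f z ℕ.≤ value g z

restrict-mono : ∀ {f g} C → f ≤ˢ g → restrict f C ≤ˢ restrict g C
restrict-mono C f≤g z with Clopen.χ C z
... | false = z≤n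
... | true  = f≤g z

restrict-split : ∀ f C z → value (restrict f C) z ℕ.+ value (restrict f (∁ᶜ C)) z ≡ value f z
restrict-split f C z with Clopen.χ C z
... | false = ≡.refl
... | true  = ℕ.+-identityʳ _

-- The number of summands grows along with the functions, as in the diagonal cover of a countable
-- union.
total-mono : ∀ {F G} → (∀ i → F i ≤ˢ G i) → ∀ n → total F n ≤ˢ total G (suc n)
total-mono F≤G zero    z = z≤n
total-mono {F} {G} F≤G (suc n) z = ℕ.+-mono-≤ (F≤G 0 z) (total-mono {F ∘ suc} {G ∘ suc} (F≤G ∘ suc) n z)

term≤total : ∀ F {i n} → i ℕ.< n → F i ≤ˢ total F n
term≤total F {zero}  (s≤s _)   z = ℕ.m≤m+n _ _
term≤total F {suc i} (s≤s i<n) z = ℕ.≤-trans (term≤total (F ∘ suc) i<n z) (ℕ.m≤n+m _ _)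

birkhoff-mono : ∀ {f g : Sequence → ℕ} → (∀ z → f z ℕ.≤ g z) → ∀ k z → birkhoff f k z ℕ.≤ birkhoff g k z
birkhoff-mono f≤g zero    z = z≤n
birkhoff-mono f≤g (suc k) z = ℕ.+-mono-≤ (f≤g z) (birkhoff-mono f≤g k (shift z))

birkhoff-⊕ : ∀ f g k z → birkhoff (value (f ⊕ g)) k z ≡ birkhoff (value f) k z ℕ.+ birkhoff (value g) k z
birkhoff-⊕ f g zero    z = ≡.refl
birkhoff-⊕ f g (suc k) z = ≡.trans (≡.cong (value f z ℕ.+ value g z ℕ.+_) (birkhoff-⊕ f g k (shift z)))
  (solve 4 (λ a b c d → a :+ b :+ (c :+ d) := a :+ c :+ (b :+ d)) ≡.refl (value f z) (value g z) _ _)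
  where open +-*-Solver

birkhoff-shifted : ∀ (f : Sequence → ℕ) k z → birkhoff (f ∘ shift) k z ≡ birkhoff f k (shift z)
birkhoff-shifted f zero    z = ≡.refl
birkhoff-shifted f (suc k) z = ≡.cong (f (shift z) ℕ.+_) (birkhoff-shifted f k (shift z))

birkhoff-constant : ∀ c k z → birkhoff (λ _ → c) k z ≡ k ℕ.* c
birkhoff-constant c zero    z = ≡.refl
birkhoff-constant c (suc k) z = ≡.cong (c ℕ.+_) (birkhoff-constant c k (shift z))

birkhoff-positive : ∀ f k z → (∀ i → 1 ℕ.≤ value f (drop i z)) → k ℕ.≤ birkhoff (value f) k z
birkhoff-positive f zero    z 1≤f = z≤n
birkhoff-positive f (suc k) z 1≤f = ℕ.+-mono-≤ (1≤f 0) (birkhoff-positive f k (shift z) (1≤f ∘ suc))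

drop-suc : ∀ a (z : Sequence) → shift (drop a z) ≗ drop (suc a) z
drop-suc a z i = ≡.cong z (ℕ.+-suc a i)

-- The rate of a locally constant function.

module Frequency (em : ExcludedMiddle 0ℓ) (ℝ : CompleteOrderedField) (ω : Sequence)
                 (rates : Rates.HasUniformRates em ℝ ω) where
  open OrderedField em ℝ
  open Rates em ℝ

  -- Both rates bound the same sums over initial segments of arbitrary length `k`.
  lower≤upper : ∀ {f α β} → LowerRate ω f α → UpperRate ω f β → α ≤ β
  lower≤upper (C , lo) (D , hi) = slope-≤ (D + C) λ k →
    ≤-trans (lo 0 k) (≤-respʳ-≈ (+-assoc _ _ _) (+-mono-≤ (hi 0 k) ≤-refl))

  private
    rate-complete : ∀ f → ∃[ s ] (s ∈ UpperBound (LowerRate ω f) × (∀ b → b ∈ UpperBound (LowerRate ω f) → s ≤ b))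
    rate-complete f =
      let α , β , lo , hi , _ = rates f 1# 0<1
      in complete (LowerRate ω f) (α , lo) (β , λ x lo′ → lower≤upper {f} lo′ hi)

  abstract
    -- The supremum of the lower rates, which is also the infimum of the upper rates because the two
    -- come arbitrarily close. The two bounds below are all that is visible of it outside this
    -- block.
    rate : Simple → Carrier
    rate f = proj₁ (rate-complete f)

    lower≤rate : ∀ {f α} → LowerRate ω f α → α ≤ rate f
    lower≤rate {f} {α} lo = proj₁ (proj₂ (rate-complete f)) α lo

    rate≤upper : ∀ {f β} → UpperRate ω f β → rate f ≤ β
    rate≤upper {f} {β} hi = proj₂ (proj₂ (rate-complete f)) β λ _ lo → lower≤upper {f} lo hi

  rate-from-below : ∀ f ε → 0# < ε → ∃[ α ] (LowerRate ω f α × rate f ≤ α + ε)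
  rate-from-below f ε 0<ε = let α , β , lo , hi , β≤ = rates f ε 0<ε in α , lo , ≤-trans (rate≤upper {f} hi) β≤

  rate-from-above : ∀ f ε → 0# < ε → ∃[ β ] (UpperRate ω f β × β ≤ rate f + ε)
  rate-from-above f ε 0<ε = let α , β , lo , hi , β≤ = rates f ε 0<ε in β , hi , ≤-trans β≤ (+-mono-≤ (lower≤rate {f} lo) ≤-refl)

  private
    S : Simple → ℕ → ℕ → ℕ
    S f a k = birkhoff (value f) k (drop a ω)

  upper-resp : ∀ {f g β} → (∀ a k → S f a k ℕ.≤ S g a k) → UpperRate ω g β → UpperRate ω f β
  upper-resp f≤g (C , hi) = C , λ a k → ≤-trans (fromℕ-mono-≤ (f≤g a k)) (hi a k)

  rate-mono : ∀ {f g} → f ≤ˢ g → rate f ≤ rate g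
  rate-mono {f} {g} f≤g = ≤-fromε λ ε 0<ε →
    let β , hi , β≤ = rate-from-above g ε 0<ε
    in ≤-trans (rate≤upper {f} (upper-resp {f} {g} (λ a k → birkhoff-mono f≤g k _) hi)) β≤

  -- Upper rates add, and they approximate `rate` from above. The converse inequality comes in the
  -- same way from lower rates.
  rate-⊕-≤ : ∀ f g → rate (f ⊕ g) ≤ rate f + rate g
  rate-⊕-≤ f g = ≤-fromε λ ε 0<ε →
    let δ = ½ * ε
        0<δ = *-pos 0<½ 0<ε
        β , (C , hi) , β≤ = rate-from-above f δ 0<δ
        γ , (D , hi′) , γ≤ = rate-from-above g δ 0<δ
    in ≤-trans (rate≤upper {f ⊕ g} (C + D , λ a k → add {k} {s = S f a k} {S g a k} (hi a k) (hi′ a k) (birkhoff-⊕ f g k _)))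
         (≤-trans (+-mono-≤ β≤ γ≤) (≤-reflexive (trans (solve 3 (λ x y d → x :+ d :+ (y :+ d) := x :+ y :+ (d :+ d)) refl (rate f) (rate g) δ) (+-congˡ (½-double ε)))))
    where
    add : ∀ {k β γ C D s t u} → fromℕ s ≤ fromℕ k * β + C → fromℕ t ≤ fromℕ k * γ + D → u ≡ s ℕ.+ t → fromℕ u ≤ fromℕ k * (β + γ) + (C + D)
    add {k} {β} {γ} {C} {D} {s} {t} s≤ t≤ ≡.refl = ≤-respˡ-≈ (sym (fromℕ-+ s t)) (≤-respʳ-≈
      (solve 5 (λ k b g c d → k :* b :+ c :+ (k :* g :+ d) := k :* (b :+ g) :+ (c :+ d)) refl (fromℕ k) β γ C D) (+-mono-≤ s≤ t≤))

  rate-⊕-≥ : ∀ f g → rate f + rate g ≤ rate (f ⊕ g)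
  rate-⊕-≥ f g = ≤-fromε λ ε 0<ε →
    let δ = ½ * ε
        0<δ = *-pos 0<½ 0<ε
        α , (C , lo) , ≤α = rate-from-below f δ 0<δ
        γ , (D , lo′) , ≤γ = rate-from-below g δ 0<δ
    in ≤-trans (+-mono-≤ ≤α ≤γ) (≤-trans (≤-reflexive (trans (solve 3 (λ x y d → x :+ d :+ (y :+ d) := x :+ y :+ (d :+ d)) refl α γ δ) (+-congˡ (½-double ε))))
         (+-mono-≤ (lower≤rate {f ⊕ g} (C + D , λ a k → add {k} {s = S f a k} {S g a k} (lo a k) (lo′ a k) (birkhoff-⊕ f g k _))) ≤-refl))
    where
    add : ∀ {k β γ C D s t u} → fromℕ k * β ≤ fromℕ s + C → fromℕ k * γ ≤ fromℕ t + D → u ≡ s ℕ.+ t → fromℕ k * (β + γ) ≤ fromℕ u + (C + D)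
    add {k} {β} {γ} {C} {D} {s} {t} ≤s ≤t ≡.refl = ≤-respˡ-≈ (sym (distribˡ _ _ _)) (≤-trans (+-mono-≤ ≤s ≤t) (≤-reflexive
      (trans (solve 4 (λ s t c d → s :+ c :+ (t :+ d) := s :+ t :+ (c :+ d)) refl (fromℕ s) (fromℕ t) C D) (+-congʳ (sym (fromℕ-+ s t))))))

  0≤rate : ∀ f → 0# ≤ rate f
  0≤rate f = lower≤rate {f} (0# , λ a k → ≤-respˡ-≈ (sym (zeroʳ _)) (≤-respʳ-≈ (sym (+-identityʳ _)) (0≤fromℕ (S f a k))))

  rate-constant : ∀ c → rate (constant c) ≤ fromℕ c
  rate-constant c = rate≤upper {constant c} (0# , λ a k → ≤-reflexive (trans (reflexive (≡.cong fromℕ (birkhoff-constant c k (drop a ω)))) (trans (fromℕ-* k c) (sym (+-identityʳ _)))))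

  1≤rate : ∀ f → (∀ a → 1 ℕ.≤ value f (drop a ω)) → 1# ≤ rate f
  1≤rate f 1≤f = lower≤rate {f} (0# , λ a k → ≤-respˡ-≈ (sym (*-identityʳ _)) (≤-respʳ-≈ (sym (+-identityʳ _)) (fromℕ-mono-≤ (birkhoff-positive f k (drop a ω)
    λ i → ℕ.≤-trans (1≤f (a ℕ.+ i)) (ℕ.≤-reflexive (local f λ j _ → ≡.cong ω (ℕ.+-assoc a i j)))))))

  -- Shifting moves the start of an orbit segment from `a` to `suc a`, and an upper rate holds for
  -- all starts with the same constant.
  rate-shifted : ∀ f → rate (shifted f) ≤ rate f
  rate-shifted f = ≤-fromε λ ε 0<ε →
    let β , (C , hi) , β≤ = rate-from-above f ε 0<ε
    in ≤-trans (rate≤upper {shifted f} (C , λ a k → ≡.subst (λ s → fromℕ s ≤ fromℕ k * β + C)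
         (≡.sym (≡.trans (birkhoff-shifted (value f) k (drop a ω)) (birkhoff-cong f k (drop-suc a ω)))) (hi (suc a) k))) β≤

-- The measure

module Sums (em : ExcludedMiddle 0ℓ) (ℝ : CompleteOrderedField) where
  open OrderedField em ℝ

  partial : (ℕ → Carrier) → ℕ → Carrier
  partial g n = sum {n} (g ∘ toℕ)

  partial-suc : ∀ g n → partial g (suc n) ≈ partial g n + g n
  partial-suc g zero    = +-comm _ _
  partial-suc g (suc n) = trans (+-congˡ (partial-suc (g ∘ suc) n)) (sym (+-assoc _ _ _))

  partial-mono : ∀ {g h} → (∀ i → g i ≤ h i) → ∀ n → partial g n ≤ partial h n
  partial-mono g≤h zero    = ≤-refl
  partial-mono g≤h (suc n) = +-mono-≤ (g≤h 0) (partial-mono (g≤h ∘ suc) n)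

  partial-+ : ∀ g h n → partial (λ i → g i + h i) n ≈ partial g n + partial h n
  partial-+ g h zero    = sym (+-identityʳ 0#)
  partial-+ g h (suc n) = trans (+-congˡ (partial-+ (g ∘ suc) (h ∘ suc) n))
    (solve 4 (λ a b c d → a :+ b :+ (c :+ d) := a :+ c :+ (b :+ d)) refl (g 0) (h 0) _ _)

  partial-const : ∀ x n → partial (λ _ → x) n ≈ fromℕ n * x
  partial-const x zero    = sym (zeroˡ x)
  partial-const x (suc n) = trans (+-congˡ (partial-const x n)) (solve 2 (λ x n → x :+ n :* x := (𝟙 :+ n) :* x) refl x (fromℕ n))

  partial-increasing : ∀ {g} → (∀ i → 0# ≤ g i) → ∀ {m n} → m ℕ.≤ n → partial g m ≤ partial g n
  partial-increasing 0≤g {n = zero}  z≤n       = ≤-refl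
  partial-increasing 0≤g {n = suc n} z≤n       = ≤-respˡ-≈ (+-identityˡ 0#) (+-mono-≤ (0≤g 0) (partial-increasing (0≤g ∘ suc) {0} {n} z≤n))
  partial-increasing 0≤g             (s≤s m≤n) = +-monoʳ-≤ _ (partial-increasing (0≤g ∘ suc) m≤n)

  partial-geometric : ∀ {x} → 0# ≤ x → ∀ n → partial (λ i → x * ½^ (suc i)) n ≤ x
  partial-geometric {x} 0≤x zero    = 0≤x
  partial-geometric {x} 0≤x (suc n) = begin
    x * (½ * 1#) + partial (λ i → x * ½^ (suc (suc i))) n  ≤⟨ +-mono-≤ (≤-reflexive (trans (*-congˡ (*-identityʳ ½)) (*-comm x ½)))
      (≤-trans (partial-mono (λ i → ≤-reflexive (solve 3 (λ x h p → x :* (h :* p) := h :* x :* p) refl x ½ (½^ (suc i)))) n)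
        (partial-geometric (*-nonNeg (proj₁ 0<½) 0≤x) n)) ⟩
    ½ * x + ½ * x                                          ≈⟨ ½-double x ⟩
    x                                                      ∎
    where open ≤-Reasoning

  -- Partial sums of nonnegative terms increase, so once one of them exceeds `s - ε` all later ones
  -- do; if none did, `s - ε` would be a smaller upper bound.
  hasSum-sup : ∀ {g s} → (∀ i → 0# ≤ g i) → (∀ n → partial g n ≤ s) → (∀ b → (∀ n → partial g n ≤ b) → s ≤ b) → HasSum g s
  hasSum-sup {g} {s} 0≤g below least ε 0<ε with em {∃[ M ] ¬ (partial g M ≤ s - ε)}
  ... | yes (M , large) = M , λ m M≤m →
    let large′ = partial-increasing 0≤g M≤m in
    (≤-trans (proj₁ (≰⇒> large)) large′ , λ eq → large (≤-trans large′ (≤-reflexive (sym eq)))) ,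
    (≤-trans (below m) s≤s+ε , λ eq → <⇒≱ 0<ε (linear (≤-respˡ-≈ eq (below m)) (solve 2 (λ s e → con (ℤ.+ 0) :- e := s :- (s :+ e)) refl s ε)))
    where
    s≤s+ε : s ≤ s + ε
    s≤s+ε = linear (proj₁ 0<ε) (solve 2 (λ s e → s :+ e :- s := e :- con (ℤ.+ 0)) refl s ε)
  ... | no none = ⊥-elim (<⇒≱ 0<ε (linear (least (s - ε) bounded-by) (solve 2 (λ s e → con (ℤ.+ 0) :- e := s :- e :- s) refl s ε)))
    where
    bounded-by : ∀ n → partial g n ≤ s - ε
    bounded-by n with em {partial g n ≤ s - ε}
    ... | yes le = le
    ... | no ¬le = ⊥-elim (none (n , ¬le))

  hasSum-≤ : ∀ {g s b} → HasSum g s → (∀ n → partial g n ≤ b) → s ≤ b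
  hasSum-≤ {g} {s} {b} has below = ≤-fromε λ ε 0<ε → let M , close = has ε 0<ε in
    linear (≤-trans (proj₁ (proj₁ (close M ℕ.≤-refl))) (below M)) (solve 3 (λ s e b → b :+ e :- s := b :- (s :- e)) refl s ε b)

  -- The bound is asked of partial sums with at least two terms, to suit series that vanish after
  -- their first two terms.
  hasSum-≥ : ∀ {g s b} → HasSum g s → (∀ n → b ≤ partial g (suc (suc n))) → b ≤ s
  hasSum-≥ {g} {s} {b} has above = ≤-fromε λ ε 0<ε → let M , close = has ε 0<ε in
    ≤-trans (above M) (proj₁ (proj₂ (close (suc (suc M)) (ℕ.m≤n⇒m≤1+n (ℕ.n≤1+n M)))))

least : ExcludedMiddle 0ℓ → (P : ℕ → Set) → ∃ P → ∃[ m ] (P m × (∀ j → j ℕ.< m → ¬ P j))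
least em P (n , Pn) = search n 0 (ℕ.≤-reflexive (≡.sym (ℕ.+-identityʳ n))) (λ _ ()) 
  where
  -- The number `k` is fuel: it bounds the distance from the candidate `m` to the known witness `n`.
  search : ∀ k m → n ℕ.≤ k ℕ.+ m → (∀ j → j ℕ.< m → ¬ P j) → ∃[ m ] (P m × (∀ j → j ℕ.< m → ¬ P j))
  search k m n≤ none with em {P m}
  ... | yes Pm = m , Pm , none
  search zero m n≤ none | no ¬Pm with ℕ.m≤n⇒m<n∨m≡n n≤
  ... | inj₁ n<m    = ⊥-elim (none n n<m Pn)
  ... | inj₂ ≡.refl = ⊥-elim (¬Pm Pn)
  search (suc k) m n≤ none | no ¬Pm = search k (suc m) (ℕ.≤-trans n≤ (ℕ.≤-reflexive (≡.sym (ℕ.+-suc k m)))) below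
    where
    below : ∀ j → j ℕ.< suc m → ¬ P j
    below j (s≤s j≤m) with ℕ.m≤n⇒m<n∨m≡n j≤m
    ... | inj₁ j<m    = none j j<m
    ... | inj₂ ≡.refl = ¬Pm

-- The outer measure and its restriction to Borel sets.

module OuterMeasure (em : ExcludedMiddle 0ℓ) (ℝ : CompleteOrderedField) (ω : Sequence)
                    (rates : Rates.HasUniformRates em ℝ ω) where
  open OrderedField em ℝ
  open Sums em ℝ
  open Frequency em ℝ ω rates

  Point : Set
  Point = ∃ (X ω)

  private
    Event : Set₁
    Event = Pred Point 0ℓ

  record Cover (V : Event) (r : Carrier) : Set where
    field
      cover      : ℕ → Simple
      increasing : ∀ n → cover n ≤ˢ cover (suc n)
      covers     : ∀ p → p ∈ V → ∃[ n ] 1 ℕ.≤ value (cover n) (proj₁ p)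
      rate≤      : ∀ n → rate (cover n) ≤ r

    cover-mono : ∀ {m n} → m ℕ.≤ n → cover m ≤ˢ cover n
    cover-mono {m} {n} m≤n z = ≡.subst (λ k → value (cover m) z ℕ.≤ value (cover k) z) (ℕ.m∸n+n≡m m≤n) (go (n ℕ.∸ m))
      where
      go : ∀ d → value (cover m) z ℕ.≤ value (cover (d ℕ.+ m)) z
      go zero    = ℕ.≤-refl
      go (suc d) = ℕ.≤-trans (go d) (increasing (d ℕ.+ m) z)
  open Cover

  constant-cover : ∀ {V} c → (∀ p → p ∈ V → 1 ℕ.≤ c) → Cover V (fromℕ c)
  constant-cover c 1≤c = record
    { cover = λ _ → constant c ; increasing = λ _ _ → ℕ.≤-refl
    ; covers = λ p p∈V → 0 , 1≤c p p∈V ; rate≤ = λ _ → rate-constant c }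

  private
    -- Completeness is stated for suprema, so the infimum of the `r` that admit a cover is formed as
    -- the supremum of their lower bounds.
    Below : Event → Carrier → Set
    Below V y = ∀ r → Cover V r → y ≤ r

    outer-complete : ∀ V → ∃[ s ] (s ∈ UpperBound (Below V) × (∀ b → b ∈ UpperBound (Below V) → s ≤ b))
    outer-complete V = complete (Below V) (0# , λ r c → ≤-trans (0≤rate (cover c 0)) (rate≤ c 0))
      (fromℕ 1 , λ y below → below (fromℕ 1) (constant-cover 1 λ _ _ → ℕ.≤-refl))

  abstract
    μ* : Event → Carrier
    μ* V = proj₁ (outer-complete V)

    μ*≤ : ∀ {V r} → Cover V r → μ* V ≤ r
    μ*≤ {V} {r} c = proj₂ (proj₂ (outer-complete V)) r λ y below → below r c

    ≤μ* : ∀ {V y} → (∀ r → Cover V r → y ≤ r) → y ≤ μ* V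
    ≤μ* {V} {y} = proj₁ (proj₂ (outer-complete V)) y

  μ*-approximation : ∀ V ε → 0# < ε → ∃[ r ] (Cover V r × r ≤ μ* V + ε)
  μ*-approximation V ε 0<ε with em {∃[ r ] (Cover V r × r ≤ μ* V + ε)}
  ... | yes found = found
  ... | no none = ⊥-elim (<⇒≱ 0<ε (linear (≤μ* {V} {μ* V + ε} above) (solve 2 (λ m e → con (ℤ.+ 0) :- e := m :- (m :+ e)) refl (μ* V) ε)))
    where
    above : ∀ r → Cover V r → μ* V + ε ≤ r
    above r c with em {r ≤ μ* V + ε}
    ... | yes le = ⊥-elim (none (r , c , le))
    ... | no ¬le = proj₁ (≰⇒> ¬le)

  0≤μ* : ∀ V → 0# ≤ μ* V
  0≤μ* V = ≤μ* λ r c → ≤-trans (0≤rate (cover c 0)) (rate≤ c 0)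

  μ*-mono : ∀ {V W} → V ⊆ W → μ* V ≤ μ* W
  μ*-mono {V} {W} V⊆W = ≤μ* λ r c → μ*≤ record
    { cover = cover c ; increasing = increasing c ; covers = λ p p∈V → covers c p (V⊆W p∈V) ; rate≤ = rate≤ c }

  μ*-∅ : μ* ∅ ≤ 0#
  μ*-∅ = μ*≤ (constant-cover 0 λ _ ())

  μ*-U≤1 : μ* U ≤ 1#
  μ*-U≤1 = ≤-respʳ-≈ fromℕ-1 (μ*≤ (constant-cover 1 λ _ _ → ℕ.≤-refl))

  rate-total : ∀ F n → rate (total F n) ≤ partial (rate ∘ F) n
  rate-total F zero    = rate-constant 0
  rate-total F (suc n) = ≤-trans (rate-⊕-≤ (F 0) (total (F ∘ suc) n)) (+-monoʳ-≤ _ (rate-total (F ∘ suc) n))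

  -- The `n`-th function of the diagonal cover adds up the `n`-th functions of the first `n` given
  -- covers. Its rate is therefore bounded by a finite partial sum.
  μ*-⋃ : ∀ (V : ℕ → Event) r → (∀ n → partial (μ* ∘ V) n ≤ r) → μ* (⋃ ℕ V) ≤ r
  μ*-⋃ V r sums≤r = ≤-fromε λ ε 0<ε →
    -- The excesses form a geometric series with total at most `ε`.
    let approximations i = μ*-approximation (V i) (ε * ½^ (suc i)) (*-pos 0<ε (0<½^ (suc i)))
        C i = proj₁ (proj₂ (approximations i))
    in μ*≤ record
      { cover      = λ n → total (λ i → cover (C i) n) n
      ; increasing = λ n → total-mono {λ i → cover (C i) n} {λ i → cover (C i) (suc n)} (λ i → increasing (C i) n) n
      ; covers     = λ (p , p∈X) (i , p∈V) →
          let n , 1≤ = covers (C i) (p , p∈X) p∈V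
              -- At this index the `i`-th cover is among the summands and has passed its own index
              -- `n`.
              m      = suc i ℕ.+ n
          in m , ℕ.≤-trans 1≤ (ℕ.≤-trans (cover-mono (C i) (ℕ.m≤n+m n (suc i)) p)
               (term≤total (λ i → cover (C i) m) (ℕ.m≤m+n (suc i) n) p))
      ; rate≤      = λ n → begin
          rate (total (λ i → cover (C i) n) n)                           ≤⟨ rate-total (λ i → cover (C i) n) n ⟩
          partial (λ i → rate (cover (C i) n)) n                         ≤⟨ partial-mono (λ i → ≤-trans (rate≤ (C i) n) (proj₂ (proj₂ (approximations i)))) n ⟩
          partial (λ i → μ* (V i) + ε * ½^ (suc i)) n                    ≈⟨ partial-+ (μ* ∘ V) (λ i → ε * ½^ (suc i)) n ⟩
          partial (μ* ∘ V) n + partial (λ i → ε * ½^ (suc i)) n          ≤⟨ +-mono-≤ (sums≤r n) (partial-geometric (proj₁ 0<ε) n) ⟩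
          r + ε                                                          ∎
      }
    where open ≤-Reasoning

  -- Carathéodory's criterion

  Measurable : Event → Set₁
  Measurable E = ∀ A → μ* (A ∩ E) + μ* (A ∩ ∁ E) ≤ μ* A

  measurable-∁ : ∀ {E} → Measurable E → Measurable (∁ E)
  measurable-∁ {E} mE A = ≤-trans (+-mono-≤ ≤-refl (μ*-mono λ (a , ¬¬e) → a , stable ¬¬e)) (≤-respˡ-≈ (+-comm _ _) (mE A))
    where
    stable : ∀ {p} → ¬ ¬ (p ∈ E) → p ∈ E
    stable {p} ¬¬e with em {p ∈ E}
    ... | yes e = e
    ... | no ¬e = ⊥-elim (¬¬e ¬e)

  measurable-resp : ∀ {E F} → E ≐ F → Measurable E → Measurable F
  measurable-resp (E⊆F , F⊆E) mE A = ≤-trans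
    (+-mono-≤ (μ*-mono λ (a , f) → a , F⊆E f) (μ*-mono λ (a , ¬f) → a , λ e → ¬f (E⊆F e))) (mE A)

  -- Restricting a cover of `A` to `C` and to its complement gives covers of the two parts, and by
  -- additivity the two rates sum to at most the original bound.
  measurable-clopen : ∀ C → Measurable (λ p → Clopen.χ C (proj₁ p) ≡ true)
  measurable-clopen C A = ≤μ* λ r c →
    let inside n  = restrict (cover c n) C
        outside n = restrict (cover c n) (∁ᶜ C)
        -- Functions with different indices are compared at the larger index. Independent indices
        -- allow `m` to vary first with `n` fixed, and then `n`.
        both : ∀ m n → rate (inside m) + rate (outside n) ≤ r
        both m n = let k = m ℕ.⊔ n in
          ≤-trans (+-mono-≤ (rate-mono {inside m} {inside k} (restrict-mono {cover c m} {cover c k} C (cover-mono c (ℕ.m≤m⊔n m n))))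
                            (rate-mono {outside n} {outside k} (restrict-mono {cover c n} {cover c k} (∁ᶜ C) (cover-mono c (ℕ.m≤n⊔m m n)))))
          (≤-trans (rate-⊕-≥ (inside k) (outside k))
          (≤-trans (rate-mono {inside k ⊕ outside k} {cover c k} (λ z → ℕ.≤-reflexive (restrict-split (cover c k) C z))) (rate≤ c k)))
        μ-inside : ∀ n → μ* (A ∩ E) ≤ r - rate (outside n)
        μ-inside n = μ*≤ record
          { cover = inside ; increasing = λ m → restrict-mono {cover c m} {cover c (suc m)} C (increasing c m)
          ; covers = λ p (a , e) → let m , 1≤ = covers c p a in m , ≡.subst (λ b → 1 ℕ.≤ (if b then value (cover c m) (proj₁ p) else 0)) (≡.sym e) 1≤
          ; rate≤ = λ m → linear (both m n) (solve 3 (λ x y r → r :- y :- x := r :- (x :+ y)) refl (rate (inside m)) (rate (outside n)) r) }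
        μ-outside : μ* (A ∩ ∁ E) ≤ r - μ* (A ∩ E)
        μ-outside = μ*≤ record
          { cover = outside ; increasing = λ m → restrict-mono {cover c m} {cover c (suc m)} (∁ᶜ C) (increasing c m)
          ; covers = λ p (a , ¬e) → let m , 1≤ = covers c p a in m , ≡.subst (λ b → 1 ℕ.≤ (if b then value (cover c m) (proj₁ p) else 0)) (≡.sym (≡.cong not (false≡ ¬e))) 1≤
          ; rate≤ = λ n → linear (μ-inside n) (solve 3 (λ x y r → r :- x :- y := r :- y :- x) refl (μ* (A ∩ E)) (rate (outside n)) r) }
    in linear μ-outside (solve 3 (λ x y r → r :- (x :+ y) := r :- x :- y) refl (μ* (A ∩ E)) (μ* (A ∩ ∁ E)) r)
    where
    E : Event
    E p = Clopen.χ C (proj₁ p) ≡ true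
    false≡ : ∀ {b} → ¬ (b ≡ true) → b ≡ false
    false≡ {false} _  = ≡.refl
    false≡ {true}  ¬t = ⊥-elim (¬t ≡.refl)

  module _ {E : ℕ → Event} (mE : ∀ n → Measurable (E n)) where
    before : ℕ → Event
    before n p = ∃[ j ] (j ℕ.< n × p ∈ E j)

    fresh : ℕ → Event
    fresh n = E n ∩ ∁ (before n)

    -- Each step applies the criterion for `E n` to the test set `A ∩ ∁ (before n)`, which splits
    -- off the part of `A` that lies in `E n` but in no earlier set.
    fresh-sums : ∀ A n → partial (λ i → μ* (A ∩ fresh i)) n + μ* (A ∩ ∁ (before n)) ≤ μ* A
    fresh-sums A zero    = ≤-respˡ-≈ (sym (+-identityˡ _)) (μ*-mono proj₁)
    fresh-sums A (suc n) = begin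
      partial (λ i → μ* (A ∩ fresh i)) (suc n) + μ* (A ∩ ∁ (before (suc n)))              ≈⟨ +-congʳ (partial-suc (λ i → μ* (A ∩ fresh i)) n) ⟩
      (partial (λ i → μ* (A ∩ fresh i)) n + μ* (A ∩ fresh n)) + μ* (A ∩ ∁ (before (suc n))) ≈⟨ +-assoc _ _ _ ⟩
      partial (λ i → μ* (A ∩ fresh i)) n + (μ* (A ∩ fresh n) + μ* (A ∩ ∁ (before (suc n)))) ≤⟨ +-monoʳ-≤ _ (+-mono-≤
          (μ*-mono λ (a , e , ¬b) → (a , ¬b) , e)
          (μ*-mono λ (a , ¬b) → (a , λ (j , j<n , e) → ¬b (j , ℕ.m≤n⇒m≤1+n j<n , e)) , λ e → ¬b (n , ℕ.≤-refl , e))) ⟩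
      partial (λ i → μ* (A ∩ fresh i)) n + (μ* ((A ∩ ∁ (before n)) ∩ E n) + μ* ((A ∩ ∁ (before n)) ∩ ∁ (E n))) ≤⟨ +-monoʳ-≤ _ (mE n (A ∩ ∁ (before n))) ⟩
      partial (λ i → μ* (A ∩ fresh i)) n + μ* (A ∩ ∁ (before n))                          ≤⟨ fresh-sums A n ⟩
      μ* A                                                                                ∎
      where open ≤-Reasoning

    fresh-sums-≤ : ∀ A n → partial (λ i → μ* (A ∩ fresh i)) n ≤ μ* A - μ* (A ∩ ∁ (⋃ ℕ E))
    fresh-sums-≤ A n = linear (≤-trans (+-monoʳ-≤ _ (μ*-mono λ (a , ¬e) → a , λ (j , _ , e) → ¬e (j , e))) (fresh-sums A n))
      (solve 3 (λ x y r → r :- y :- x := r :- (x :+ y)) refl (partial (λ i → μ* (A ∩ fresh i)) n) (μ* (A ∩ ∁ (⋃ ℕ E))) (μ* A))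

    ⋃-fresh : ∀ (A : Event) → A ∩ ⋃ ℕ E ⊆ ⋃ ℕ (λ i → A ∩ fresh i)
    ⋃-fresh A {p} (a , e) = let n , e′ , first = least em (λ n → p ∈ E n) e in
      n , a , e′ , λ (j , j<n , e″) → first j j<n e″

    -- The fresh parts cover `A ∩ ⋃ ℕ E`, and their sums leave room for the measure of the rest of
    -- `A`; countable subadditivity passes to the limit.
    measurable-⋃ : Measurable (⋃ ℕ E)
    measurable-⋃ A = linear (≤-trans (μ*-mono (⋃-fresh A)) (μ*-⋃ (λ i → A ∩ fresh i) _ (fresh-sums-≤ A)))
      (solve 3 (λ x y r → r :- (x :+ y) := r :- y :- x) refl (μ* (A ∩ ⋃ ℕ E)) (μ* (A ∩ ∁ (⋃ ℕ E))) (μ* A))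

    -- With the union itself as test set, disjointness puts each `E i` inside its fresh part, so the
    -- partial sums stay below the measure of the union. Subadditivity makes that measure their
    -- least upper bound.
    μ*-additive : (∀ m n → m ≢ n → E m ⊥ E n) → HasSum (μ* ∘ E) (μ* (⋃ ℕ E))
    μ*-additive disjoint = hasSum-sup (0≤μ* ∘ E)
      (λ n → ≤-trans (partial-mono {μ* ∘ E} {λ i → μ* (⋃ ℕ E ∩ fresh i)} (λ i → μ*-mono λ e → (i , e) , e , λ (j , j<i , e′) → disjoint j i (ℕ.<⇒≢ j<i) (e′ , e)) n)
        (≤-trans (fresh-sums-≤ (⋃ ℕ E) n) (linear (0≤μ* (⋃ ℕ E ∩ ∁ (⋃ ℕ E))) (solve 2 (λ s t → s :- (s :- t) := t :- con (ℤ.+ 0)) refl (μ* (⋃ ℕ E)) _))))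
      (μ*-⋃ E)

  -- Compactness of the orbit closure: otherwise König's argument yields a point
  -- of it on which all functions of the cover vanish.
  module _ {r} (c : Cover U r) where
    private
      -- A set `P` of positions stands for the orbit points `drop a ω` with `a` in `P`; covered
      -- means that a single function of the cover is positive at all of them.
      Covered : (ℕ → Set) → Set
      Covered P = ∃[ n ] ∀ a → P a → 1 ℕ.≤ value (cover c n) (drop a ω)

      refine : (ℕ → Set) → ℕ → Letter → ℕ → Set
      refine P k x a = P a × ω (a ℕ.+ k) ≡ x

      -- If both choices of the letter at place `k` gave covered sets, the function at the larger of
      -- the two indices would cover all of `P`.
      extend : ∀ {P} k → ¬ Covered P → ∃[ x ] ¬ Covered (refine P k x)
      extend {P} k ¬c with em {Covered (refine P k 0F)}
      ... | no ¬c₀ = 0F , ¬c₀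
      ... | yes (n₀ , covered₀) = 1F , λ (n₁ , covered₁) → ¬c (n₀ ℕ.⊔ n₁ , λ a Pa → by-letter a Pa n₁ covered₁ (ω (a ℕ.+ k)) ≡.refl)
        where
        by-letter : ∀ a → P a → ∀ n₁ → (∀ a → refine P k 1F a → 1 ℕ.≤ value (cover c n₁) (drop a ω)) →
                    ∀ x → ω (a ℕ.+ k) ≡ x → 1 ℕ.≤ value (cover c (n₀ ℕ.⊔ n₁)) (drop a ω)
        by-letter a Pa n₁ covered₁ 0F eq = ℕ.≤-trans (covered₀ a (Pa , eq)) (cover-mono c (ℕ.m≤m⊔n n₀ n₁) (drop a ω))
        by-letter a Pa n₁ covered₁ 1F eq = ℕ.≤-trans (covered₁ a (Pa , eq)) (cover-mono c (ℕ.m≤n⊔m n₀ n₁) (drop a ω))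

      module _ (uncovered : ¬ Covered (λ _ → ⊤)) where
        stage : ℕ → Σ[ P ∈ (ℕ → Set) ] ¬ Covered P
        stage zero    = (λ _ → ⊤) , uncovered
        stage (suc k) = let P , ¬c = stage k in refine P k (proj₁ (extend k ¬c)) , proj₂ (extend k ¬c)

        z : Sequence
        z k = proj₁ (extend k (proj₂ (stage k)))

        agrees : ∀ k a → proj₁ (stage k) a → drop a ω ∈ Cylinder k z
        agrees (suc k) a (Pa , eq) i i<1+k with ℕ.m≤n⇒m<n∨m≡n (ℕ.s≤s⁻¹ i<1+k)
        ... | inj₁ i<k    = agrees k a Pa i i<k
        ... | inj₂ ≡.refl = eq

        z∈X : z ∈ X ω
        z∈X n with em {∃ (proj₁ (stage n))}
        ... | yes (a , Pa) = fold ω shift a , (a , ≡.refl) , λ i i<n → ≡.trans (fold-shift ω a i) (agrees n a Pa i i<n)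
        -- The empty set would be covered, so every stage contains a position, and its orbit point
        -- agrees with `z` on `n` letters.
        ... | no empty     = ⊥-elim (proj₂ (stage n) (0 , λ a Pa → ⊥-elim (empty (a , Pa))))

        -- A function positive at `z` is positive at all positions of stage `L`, where `L` is its
        -- window. But that stage is not covered.
        impossible : 1# ≤ r
        impossible = let n , 1≤ = covers c (z , z∈X) tt
                         L      = Simple.window (cover c n)
          in ⊥-elim (proj₂ (stage L) (n , λ a Pa → ℕ.≤-trans 1≤ (ℕ.≤-reflexive (≡.sym (local (cover c n) (agrees L a Pa))))))

    1≤cover : 1# ≤ r
    1≤cover with em {Covered (λ _ → ⊤)}
    ... | yes (n , covered) = ≤-trans (1≤rate (cover c n) (λ a → covered a tt)) (rate≤ c n)
    ... | no uncovered      = impossible uncovered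

  1≤μ*-U : 1# ≤ μ* U
  1≤μ*-U = ≤μ* λ r c → 1≤cover c

  -- Measurability of open and Borel sets; the frequency measure.

  private
    decide : Set → Bool
    decide P = does (em {P})

    decide-sound : ∀ P → decide P ≡ true → P
    decide-sound P eq with em {P}
    ... | yes p = p

    decide-complete : ∀ P → P → decide P ≡ true
    decide-complete P p with em {P}
    ... | yes _ = ≡.refl
    ... | no ¬p = ⊥-elim (¬p p)

    decide-cong : ∀ P Q → (P → Q) → (Q → P) → decide P ≡ decide Q
    decide-cong P Q P→Q Q→P with em {P} | em {Q}
    ... | yes _ | yes _ = ≡.refl
    ... | no _  | no _  = ≡.refl
    ... | yes p | no ¬q = ⊥-elim (¬q (P→Q p))
    ... | no ¬p | yes q = ⊥-elim (¬p (Q→P q))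

  module _ (W : Pred Sequence 0ℓ) where
    private
      Inner : ℕ → Sequence → Set
      Inner n z = ∀ y → y ∈ Cylinder n z → y ∈ W

      Inner-local : ∀ {n y z} → y ∈ Cylinder n z → Inner n y → Inner n z
      Inner-local y∈ inner x x∈ = inner x λ i i<n → ≡.trans (x∈ i i<n) (≡.sym (y∈ i i<n))

      inner : ℕ → Clopen
      inner n = record
        { χ = λ z → decide (Inner n z) ; window = n
        ; local = λ {y} {z} y∈ → decide-cong (Inner n y) (Inner n z) (Inner-local {n} {y} {z} y∈) (Inner-local {n} {z} {y} λ i i<n → ≡.sym (y∈ i i<n)) }

    -- An open set is the union over `n` of the clopen sets of points whose cylinder of length `n`
    -- lies in it.
    measurable-open : OpenShift W → Measurable (proj₁ ⊢ W)
    measurable-open open-W = measurable-resp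
      ((λ {p} (n , eq) → decide-sound (Inner n (proj₁ p)) eq (proj₁ p) (λ _ _ → ≡.refl)) ,
       (λ {p} p∈W → let n , inner-p = open-W (proj₁ p) p∈W in n , decide-complete (Inner n (proj₁ p)) inner-p))
      (measurable-⋃ (λ n → measurable-clopen (inner n)))

  open DynamicalSystem (orbitClosure ω) using (Open; step)

  measurable-Borel : ∀ {V} → Borel Open V → Measurable V
  measurable-Borel (open-set (W , open-W , V⊆W , W⊆V)) = measurable-resp (W⊆V , V⊆W) (measurable-open W open-W)
  measurable-Borel (complement b) = measurable-∁ (measurable-Borel b)
  measurable-Borel (union bs)     = measurable-⋃ (λ n → measurable-Borel (bs n))
  measurable-Borel (resp V≐W b)   = measurable-resp V≐W (measurable-Borel b)

  open InvariantMeasures ℝ (orbitClosure ω) hiding (μ)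

  frequencyMeasure : ProbabilityMeasure
  frequencyMeasure = record
    { μ        = λ (V , _) → μ* V
    ; μ-cong   = λ _ _ (V⊆W , W⊆V) → antisym (μ*-mono V⊆W) (μ*-mono W⊆V)
    ; μ-nonNeg = λ (V , _) → 0≤μ* V
    ; μ-∅      = λ _ → antisym μ*-∅ (0≤μ* ∅)
    ; μ-U      = λ _ → antisym μ*-U≤1 1≤μ*-U
    ; μ-⋃      = λ _ bs → μ*-additive (λ n → measurable-Borel (bs n))
    }

  -- Composing the functions of a cover with the shift gives a cover of the preimage without raising
  -- the rates.
  μ*-preimage : ∀ V → μ* (step ⊢ V) ≤ μ* V
  μ*-preimage V = ≤μ* λ r c → μ*≤ record
    { cover = shifted ∘ cover c ; increasing = λ n z → increasing c n (shift z)
    ; covers = λ p p∈V → covers c (step p) p∈V ; rate≤ = λ n → ≤-trans (rate-shifted (cover c n)) (rate≤ c n) }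

-- Unique ergodicity

module MeasureProperties (em : ExcludedMiddle 0ℓ) (ℝ : CompleteOrderedField) (S : DynamicalSystem)
                         (m : InvariantMeasures.ProbabilityMeasure ℝ S) where
  open OrderedField em ℝ
  open Sums em ℝ
  open DynamicalSystem S
  open InvariantMeasures ℝ S using (BorelSet; module ProbabilityMeasure)
  open ProbabilityMeasure m

  infixr 7 _∩ᴮ_

  ∁ᴮ : BorelSet → BorelSet
  ∁ᴮ (V , b) = ∁ V , complement b

  private
    pair : {A : Set₁} → A → A → ℕ → A
    pair x y zero    = x
    pair x y (suc _) = y

  -- De Morgan, with the union of two complements written as a countable union whose second set is
  -- repeated.
  _∩ᴮ_ : BorelSet → BorelSet → BorelSet
  (V , b) ∩ᴮ (W , c) = V ∩ W , resp {V = ∁ (⋃ ℕ (pair (∁ V) (∁ W)))} (forth , back) (complement (union both))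
    where
    both : ∀ n → Borel Open (pair (∁ V) (∁ W) n)
    both zero    = complement b
    both (suc _) = complement c
    stable : ∀ {P : Set} → ¬ ¬ P → P
    stable {P} ¬¬p with em {P}
    ... | yes p = p
    ... | no ¬p = ⊥-elim (¬¬p ¬p)
    forth : ∁ (⋃ ℕ (pair (∁ V) (∁ W))) ⊆ V ∩ W
    forth neither = stable (λ ¬v → neither (0 , ¬v)) , stable (λ ¬w → neither (1 , ¬w))
    back : V ∩ W ⊆ ∁ (⋃ ℕ (pair (∁ V) (∁ W)))
    back (v , w) (zero , ¬v)  = ¬v v
    back (v , w) (suc _ , ¬w) = ¬w w

  μ-empty : ∀ A → (∀ p → ¬ (p ∈ proj₁ A)) → μ A ≈ 0#
  μ-empty (V , b) empty = trans (μ-cong (V , b) (∅ , b∅) V≐∅) (μ-∅ b∅)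
    where
    V≐∅ : V ≐ ∅
    V≐∅ = (λ {p} v → empty p v) , λ ()
    b∅ : Borel Open ∅
    b∅ = resp V≐∅ b

  -- Countable additivity for the two parts of `A` followed by infinitely many empty sets, written
  -- `A ∩ᴮ ∁ᴮ A` so that they are Borel by construction.
  μ-split : ∀ A B → μ (A ∩ᴮ B) + μ (A ∩ᴮ ∁ᴮ B) ≈ μ A
  μ-split A@(V , b) B@(W , c) = trans (antisym (hasSum-≥ {μ ∘ part} has (λ n → ≤-reflexive (sym (partial-g n))))
      (hasSum-≤ {μ ∘ part} has λ n → ≤-trans (partial-increasing {μ ∘ part} (λ i → μ-nonNeg (part i)) (ℕ.m≤n+m n 2)) (≤-reflexive (partial-g n))))
    (μ-cong (⋃ ℕ (proj₁ ∘ part) , union (proj₂ ∘ part)) A ((λ (i , v) → in-V i v) , λ {p} v → classify p v))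
    where
    part : ℕ → BorelSet
    part zero          = A ∩ᴮ B
    part (suc zero)    = A ∩ᴮ ∁ᴮ B
    part (suc (suc _)) = A ∩ᴮ ∁ᴮ A
    disjoint : ∀ i j → i ≢ j → proj₁ (part i) ⊥ proj₁ (part j)
    disjoint zero          zero          i≢j _ = i≢j ≡.refl
    disjoint zero          (suc zero)    _ ((_ , w) , (_ , ¬w)) = ¬w w
    disjoint zero          (suc (suc _)) _ ((v , _) , (_ , ¬v)) = ¬v v
    disjoint (suc zero)    zero          _ ((_ , ¬w) , (_ , w)) = ¬w w
    disjoint (suc zero)    (suc zero)    i≢j _ = i≢j ≡.refl
    disjoint (suc zero)    (suc (suc _)) _ ((v , _) , (_ , ¬v)) = ¬v v
    disjoint (suc (suc _)) _             _ ((v , ¬v) , _) = ¬v v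
    has : HasSum (μ ∘ part) (μ (⋃ ℕ (proj₁ ∘ part) , union (proj₂ ∘ part)))
    has = μ-⋃ (proj₁ ∘ part) (proj₂ ∘ part) disjoint
    partial-0 : ∀ n → partial (μ ∘ part ∘ suc ∘ suc) n ≈ 0#
    partial-0 zero    = refl
    partial-0 (suc n) = trans (+-cong (μ-empty (A ∩ᴮ ∁ᴮ A) λ _ (v , ¬v) → ¬v v) (partial-0 n)) (+-identityʳ 0#)
    partial-g : ∀ n → partial (μ ∘ part) (suc (suc n)) ≈ μ (A ∩ᴮ B) + μ (A ∩ᴮ ∁ᴮ B)
    partial-g n = +-congˡ (trans (+-congˡ (partial-0 n)) (+-identityʳ _))
    in-V : ∀ i {p} → p ∈ proj₁ (part i) → p ∈ V
    in-V zero          = proj₁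
    in-V (suc zero)    = proj₁
    in-V (suc (suc _)) = proj₁
    classify : ∀ p → p ∈ V → p ∈ ⋃ ℕ (proj₁ ∘ part)
    classify p v with em {p ∈ W}
    ... | yes w = 0 , v , w
    ... | no ¬w = 1 , v , ¬w

  μ-mono : ∀ A B → proj₁ A ⊆ proj₁ B → μ A ≤ μ B
  μ-mono A B A⊆B = begin
    μ A                          ≈⟨ μ-cong A (B ∩ᴮ A) ((λ a → A⊆B a , a) , proj₂) ⟩
    μ (B ∩ᴮ A)                   ≈⟨ +-identityʳ _ ⟨
    μ (B ∩ᴮ A) + 0#              ≤⟨ +-monoʳ-≤ _ (μ-nonNeg (B ∩ᴮ ∁ᴮ A)) ⟩
    μ (B ∩ᴮ A) + μ (B ∩ᴮ ∁ᴮ A)   ≈⟨ μ-split B A ⟩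
    μ B                          ∎
    where open ≤-Reasoning

  μ-∁ : ∀ A → μ A + μ (∁ᴮ A) ≈ 1#
  μ-∁ A@(V , b) = begin
    μ A + μ (∁ᴮ A)               ≈⟨ +-cong (μ-cong A (Uᴮ ∩ᴮ A) ((tt ,_) , proj₂)) (μ-cong (∁ᴮ A) (Uᴮ ∩ᴮ ∁ᴮ A) ((tt ,_) , proj₂)) ⟩
    μ (Uᴮ ∩ᴮ A) + μ (Uᴮ ∩ᴮ ∁ᴮ A) ≈⟨ μ-split Uᴮ A ⟩
    μ Uᴮ                         ≈⟨ μ-U _ ⟩
    1#                           ∎
    where
    open SetoidReasoning setoid
    -- For an arbitrary `DynamicalSystem` the whole space is not known to be open, so it is
    -- presented as the complement of an empty Borel set.
    Uᴮ : BorelSet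
    Uᴮ = U , resp ((λ _ → tt) , λ _ (v , ¬v) → ¬v v) (complement (proj₂ (A ∩ᴮ ∁ᴮ A)))

  tally : (ℕ → Point → ℕ) → ℕ → Point → ℕ
  tally c zero    p = 0
  tally c (suc k) p = c 0 p ℕ.+ tally (c ∘ suc) k p

  -- Double counting, i.e. integration of the number of sets B j containing a point.
  multiplicity-bound : ∀ k (B : ℕ → BorelSet) c A R → (∀ j p → p ∈ proj₁ (B j) → 1 ℕ.≤ c j p) →
    (∀ p → p ∈ proj₁ A → fromℕ (tally c k p) ≤ R) → partial (λ j → μ (A ∩ᴮ B j)) k ≤ R * μ A
  multiplicity-bound zero B c A R 1≤c tally≤R with em {∃ (proj₁ A)}
  -- A point of `A` shows that `R` is nonnegative; without one, the right side vanishes whatever the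
  -- sign of `R`.
  ... | yes (p , a) = *-nonNeg (tally≤R p a) (μ-nonNeg A)
  ... | no empty    = ≤-reflexive (sym (trans (*-congˡ (μ-empty A λ p a → empty (p , a))) (zeroʳ R)))
  multiplicity-bound (suc k) B c A R 1≤c tally≤R = begin
    μ A₁ + partial (λ j → μ (A ∩ᴮ B (suc j))) k
      ≤⟨ +-monoʳ-≤ _ (partial-mono {λ j → μ (A ∩ᴮ B (suc j))} {λ j → μ (A₁ ∩ᴮ B (suc j)) + μ (A₀ ∩ᴮ B (suc j))} split k) ⟩
    μ A₁ + partial (λ j → μ (A₁ ∩ᴮ B (suc j)) + μ (A₀ ∩ᴮ B (suc j))) k
      ≈⟨ +-congˡ (partial-+ (λ j → μ (A₁ ∩ᴮ B (suc j))) (λ j → μ (A₀ ∩ᴮ B (suc j))) k) ⟩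
    μ A₁ + (partial (λ j → μ (A₁ ∩ᴮ B (suc j))) k + partial (λ j → μ (A₀ ∩ᴮ B (suc j))) k)
      ≤⟨ +-monoʳ-≤ _ (+-mono-≤
          (multiplicity-bound k (B ∘ suc) (c ∘ suc) A₁ (R - 1#) (1≤c ∘ suc) tally₁)
          (multiplicity-bound k (B ∘ suc) (c ∘ suc) A₀ R (1≤c ∘ suc) tally₀)) ⟩
    μ A₁ + ((R - 1#) * μ A₁ + R * μ A₀)
      ≈⟨ solve 3 (λ r x y → x :+ ((r :- 𝟙) :* x :+ r :* y) := r :* (x :+ y)) refl R (μ A₁) (μ A₀) ⟩
    R * (μ A₁ + μ A₀)
      ≈⟨ *-congˡ (μ-split A (B 0)) ⟩
    R * μ A ∎
    where
    open ≤-Reasoning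
    A₁ = A ∩ᴮ B 0
    A₀ = A ∩ᴮ ∁ᴮ (B 0)
    split : ∀ j → μ (A ∩ᴮ B (suc j)) ≤ μ (A₁ ∩ᴮ B (suc j)) + μ (A₀ ∩ᴮ B (suc j))
    split j = ≤-respˡ-≈ (μ-split (A ∩ᴮ B (suc j)) (B 0)) (+-mono-≤
      (μ-mono ((A ∩ᴮ B (suc j)) ∩ᴮ B 0) (A₁ ∩ᴮ B (suc j)) λ ((a , b) , b₀) → (a , b₀) , b)
      (μ-mono ((A ∩ᴮ B (suc j)) ∩ᴮ ∁ᴮ (B 0)) (A₀ ∩ᴮ B (suc j)) λ ((a , b) , b₀) → (a , b₀) , b))
    tally₁ : ∀ p → p ∈ proj₁ A₁ → fromℕ (tally (c ∘ suc) k p) ≤ R - 1#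
    tally₁ p (a , b) = linear (≤-trans (fromℕ-mono-≤ (ℕ.+-monoˡ-≤ (tally (c ∘ suc) k p) (1≤c 0 p b))) (tally≤R p a))
      (solve 2 (λ r t → r :- 𝟙 :- t := r :- (𝟙 :+ t)) refl R (fromℕ (tally (c ∘ suc) k p)))
    tally₀ : ∀ p → p ∈ proj₁ A₀ → fromℕ (tally (c ∘ suc) k p) ≤ R
    tally₀ p (a , _) = ≤-trans (fromℕ-mono-≤ (ℕ.m≤n+m _ (c 0 p))) (tally≤R p a)

  -- Continuity from below: layer `n` consists of the points of `A` whose first set is `B n`. The
  -- layers are disjoint, and the first `n + 1` of them lie in `A ∩ᴮ B n`.
  μ-exhaustion : ∀ A (B : ℕ → BorelSet) r → (∀ n → proj₁ (B n) ⊆ proj₁ (B (suc n))) → proj₁ A ⊆ ⋃ ℕ (proj₁ ∘ B) →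
                 (∀ n → μ (B n) ≤ r) → 0# ≤ r → μ A ≤ r
  μ-exhaustion A@(V , _) B r increasing covers μB≤r 0≤r = ≤-respˡ-≈
    (μ-cong (⋃ ℕ (proj₁ ∘ layer) , union (proj₂ ∘ layer)) A ((λ (n , l) → in-V n l) , λ {p} v → classify p v))
    (hasSum-≤ {μ ∘ layer} (μ-⋃ (proj₁ ∘ layer) (proj₂ ∘ layer) disjoint) sums≤r)
    where
    layer : ℕ → BorelSet
    layer zero    = A ∩ᴮ B 0
    layer (suc n) = (A ∩ᴮ B (suc n)) ∩ᴮ ∁ᴮ (B n)
    in-V : ∀ n {p} → p ∈ proj₁ (layer n) → p ∈ V
    in-V zero    (v , _)       = v
    in-V (suc n) ((v , _) , _) = v
    in-B : ∀ n {p} → p ∈ proj₁ (layer n) → p ∈ proj₁ (B n)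
    in-B zero    (_ , b)       = b
    in-B (suc n) ((_ , b) , _) = b
    B-mono : ∀ {i j} → i ℕ.≤′ j → proj₁ (B i) ⊆ proj₁ (B j)
    B-mono ℕ.≤′-refl           b = b
    B-mono (ℕ.≤′-step {j} i≤j) b = increasing j (B-mono i≤j b)
    later : ∀ {i j} → i ℕ.< j → proj₁ (layer i) ⊥ proj₁ (layer j)
    later {i} {suc j} (s≤s i≤j) (l , (_ , ¬b)) = ¬b (B-mono (ℕ.≤⇒≤′ i≤j) (in-B i l))
    disjoint : ∀ i j → i ≢ j → proj₁ (layer i) ⊥ proj₁ (layer j)
    disjoint i j i≢j (l , l′) with ℕ.<-cmp i j
    ... | tri< i<j _ _ = later i<j (l , l′)
    ... | tri≈ _ i≡j _ = i≢j i≡j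
    ... | tri> _ _ j<i = later j<i (l′ , l)
    classify : ∀ p → p ∈ V → p ∈ ⋃ ℕ (proj₁ ∘ layer)
    classify p v with least em (λ n → p ∈ proj₁ (B n)) (covers v)
    ... | zero  , b , _     = zero , v , b
    ... | suc n , b , first = suc n , (v , b) , first n ℕ.≤-refl
    sums : ∀ n → partial (μ ∘ layer) (suc n) ≤ μ (A ∩ᴮ B n)
    sums zero    = ≤-reflexive (+-identityʳ _)
    sums (suc n) = begin
      partial (μ ∘ layer) (suc (suc n))                                        ≈⟨ partial-suc (μ ∘ layer) (suc n) ⟩
      partial (μ ∘ layer) (suc n) + μ (layer (suc n))                          ≤⟨ +-mono-≤ (sums n) ≤-refl ⟩
      μ (A ∩ᴮ B n) + μ (layer (suc n))                                         ≤⟨ +-mono-≤ (μ-mono (A ∩ᴮ B n) ((A ∩ᴮ B (suc n)) ∩ᴮ B n) λ (a , b) → (a , increasing n b) , b) ≤-refl ⟩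
      μ ((A ∩ᴮ B (suc n)) ∩ᴮ B n) + μ (layer (suc n))                          ≈⟨ μ-split (A ∩ᴮ B (suc n)) (B n) ⟩
      μ (A ∩ᴮ B (suc n))                                                       ∎
      where open ≤-Reasoning
    sums≤r : ∀ n → partial (μ ∘ layer) n ≤ r
    sums≤r zero    = 0≤r
    sums≤r (suc n) = ≤-trans (sums n) (≤-trans (μ-mono (A ∩ᴮ B n) (B n) proj₂) (μB≤r n))

-- Invariance and uniqueness of the frequency measure.

module _ (em : ExcludedMiddle 0ℓ) (ℝ : CompleteOrderedField) (ω : Sequence)
         (rates : Rates.HasUniformRates em ℝ ω) where
  open OrderedField em ℝ
  open Rates em ℝ
  open Sums em ℝ
  open Frequency em ℝ ω rates
  open OuterMeasure em ℝ ω rates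
  open DynamicalSystem (orbitClosure ω) using (Open; step)
  open InvariantMeasures ℝ (orbitClosure ω) hiding (UniquelyErgodic)
  private
    module MP = MeasureProperties em ℝ (orbitClosure ω)

  -- Applied to a set and its complement, this turns one-sided bounds between two probability
  -- measures into equality.
  complementary-≈ : ∀ {a b c d} → a + b ≈ 1# → c + d ≈ 1# → a ≤ c → b ≤ d → a ≈ c
  complementary-≈ {a} {b} {c} {d} ab cd a≤c b≤d = antisym a≤c (linear b≤d (begin
    a - c             ≈⟨ solve 4 (λ a b c d → a :- c := (a :+ b) :- (c :+ d) :+ (d :- b)) refl a b c d ⟩
    (a + b) - (c + d) + (d - b) ≈⟨ +-congʳ (+-cong ab (-‿cong cd)) ⟩
    1# - 1# + (d - b) ≈⟨ solve 2 (λ b d → 𝟙 :- 𝟙 :+ (d :- b) := d :- b) refl b d ⟩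
    d - b             ∎))
    where open SetoidReasoning setoid

  frequency-invariant : Invariant frequencyMeasure
  frequency-invariant V = complementary-≈ (MP.μ-∁ frequencyMeasure (step⁻¹ V)) (MP.μ-∁ frequencyMeasure V)
    (μ*-preimage (proj₁ V)) (μ*-preimage (∁ (proj₁ V)))

  positivity : Simple → BorelSet
  positivity f = (λ p → 1 ℕ.≤ value f (proj₁ p)) , open-set
    ((λ z → 1 ℕ.≤ value f z) , (λ z 1≤ → Simple.window f , λ y y∈ → ℕ.≤-trans 1≤ (ℕ.≤-reflexive (≡.sym (local f y∈)))) , id , id)

  module _ (m : ProbabilityMeasure) (invariant : Invariant m) where
    open MP m

    preimages : BorelSet → ℕ → BorelSet
    preimages B zero    = B
    preimages B (suc j) = step⁻¹ (preimages B j)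

    μ-preimages : ∀ B j → μ m (preimages B j) ≈ μ m B
    μ-preimages B zero    = refl
    μ-preimages B (suc j) = trans (invariant (preimages B j)) (μ-preimages B j)

    preimages-positivity : ∀ f j p → p ∈ proj₁ (preimages (positivity f) j) → 1 ℕ.≤ value f (drop j (proj₁ p))
    preimages-positivity f zero    p 1≤ = 1≤
    preimages-positivity f (suc j) p 1≤ = preimages-positivity f j (step p) 1≤

    -- The map `h` is arbitrary so that the induction can replace it by `shift ∘ h` while `p` stays
    -- fixed.
    tally-birkhoff : ∀ (f : Sequence → ℕ) k (h : Point → Sequence) p → tally (λ j p → f (drop j (h p))) k p ≡ birkhoff f k (h p)
    tally-birkhoff f zero    h p = ≡.refl
    tally-birkhoff f (suc k) h p = ≡.cong (f (h p) ℕ.+_) (tally-birkhoff f k (shift ∘ h) p)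

    -- By invariance, `k` times the measure is the sum of the measures of `k` preimages. A point
    -- lies in at most as many of them as its Birkhoff sum, which is at most `fromℕ k * β + C`.
    μ-positivity-≤-upper : ∀ f {β} → UpperRate ω f β → μ m (positivity f) ≤ β
    μ-positivity-≤-upper f {β} (C , hi) = slope-≤ C λ k → begin
      fromℕ k * μ m (positivity f)                     ≈⟨ partial-const _ k ⟨
      partial (λ _ → μ m (positivity f)) k             ≤⟨ partial-mono {λ _ → μ m (positivity f)} {λ j → μ m (Uᴮ ∩ᴮ B j)} (λ j → ≤-reflexive (sym (trans
          (ProbabilityMeasure.μ-cong m (Uᴮ ∩ᴮ B j) (B j) (proj₂ , (tt ,_))) (μ-preimages (positivity f) j)))) k ⟩
      partial (λ j → μ m (Uᴮ ∩ᴮ B j)) k                ≤⟨ multiplicity-bound k B (λ j p → value f (drop j (proj₁ p))) Uᴮ (fromℕ k * β + C)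
          (preimages-positivity f) (λ p _ → ≤-respˡ-≈ (reflexive (≡.cong fromℕ (≡.sym (tally-birkhoff (value f) k proj₁ p)))) (everywhere k p)) ⟩
      (fromℕ k * β + C) * μ m Uᴮ                       ≈⟨ trans (*-congˡ (ProbabilityMeasure.μ-U m _)) (*-identityʳ _) ⟩
      fromℕ k * β + C                                  ∎
      where
      open ≤-Reasoning
      B = preimages (positivity f)
      Uᴮ : BorelSet
      Uᴮ = U , open-set (U , (λ _ _ → 0 , λ _ _ → tt) , id , id)
      everywhere : ∀ k (p : Point) → fromℕ (birkhoff (value f) k (proj₁ p)) ≤ fromℕ k * β + C
      everywhere k (z , z∈X) with z∈X (k ℕ.+ Simple.window f)
      -- An orbit point that agrees on `k` letters plus a window has the same Birkhoff sum, so the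
      -- bound along the orbit passes to its closure.
      ... | _ , (a , ≡.refl) , agree = ≡.subst (λ s → fromℕ s ≤ fromℕ k * β + C)
        (≡.trans (birkhoff-cong f k (λ i → ≡.sym (fold-shift ω a i))) (birkhoff-local f k agree)) (hi a k)

    μ-positivity : ∀ f → μ m (positivity f) ≤ rate f
    μ-positivity f = ≤-fromε λ ε 0<ε → let β , hi , β≤ = rate-from-above f ε 0<ε in ≤-trans (μ-positivity-≤-upper f hi) β≤

    -- The positivity sets of the functions of a cover increase and exhaust `V`, and each has
    -- measure at most the rate of its function.
    μ≤μ* : ∀ V → μ m V ≤ μ* (proj₁ V)
    μ≤μ* V = ≤μ* λ r c → let open Cover c in
      μ-exhaustion V (positivity ∘ cover) r (λ n {p} 1≤ → ℕ.≤-trans 1≤ (increasing n (proj₁ p))) (λ {p} v → covers p v)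
        (λ n → ≤-trans (μ-positivity (cover n)) (rate≤ n)) (≤-trans (0≤rate (cover 0)) (rate≤ 0))

    frequency-unique : ∀ V → μ m V ≈ μ frequencyMeasure V
    frequency-unique V = complementary-≈ (μ-∁ V) (MP.μ-∁ frequencyMeasure V) (μ≤μ* V) (μ≤μ* (∁ᴮ V))

  uniquelyErgodic : UniquelyErgodic ℝ (orbitClosure ω)
  uniquelyErgodic = frequencyMeasure , frequency-invariant , frequency-unique

-- Digits

count-zeros-++⁺ : ∀ d w → count 0F (toList (List.replicate d 0F ++⁺ w)) ≡ d ℕ.+ count 0F (toList w)
count-zeros-++⁺ zero    w = ≡.refl
count-zeros-++⁺ (suc d) w = ≡.cong suc (count-zeros-++⁺ d w)

count-ones-++⁺ : ∀ d w → count 1F (toList (List.replicate d 0F ++⁺ w)) ≡ count 1F (toList w)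
count-ones-++⁺ zero    w = ≡.refl
count-ones-++⁺ (suc d) w = count-ones-++⁺ d w

count-replicate : ∀ n c → count c (List.replicate n c) ≡ n
count-replicate zero    c  = ≡.refl
count-replicate (suc n) 0F = ≡.cong suc (count-replicate n 0F)
count-replicate (suc n) 1F = ≡.cong suc (count-replicate n 1F)

count-ones-replicate : ∀ n → count 1F (List.replicate n 0F) ≡ 0
count-ones-replicate zero    = ≡.refl
count-ones-replicate (suc n) = count-ones-replicate n

module _ (N : ℕ) .{{_ : NonZero N}} {d : ℕ} (2≤N : 2 ℕ.≤ N) (N≤d : N ℕ.≤ d) where
  private
    2≤d : 2 ℕ.≤ d
    2≤d = ℕ.≤-trans 2≤N N≤d

    power : Letter → Word
    power = List⁺.replicate N (≢-nonZero⁻¹ N)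

    count-power : ∀ c → count c (toList (power c)) ≡ N
    count-power c = ≡.trans (count-replicate (suc (ℕ.pred N)) c) (ℕ.suc-pred N)

    ≤-count-zeros : ∀ w {k} → k ℕ.≤ d → k ℕ.≤ count 0F (toList (List.replicate d 0F ++⁺ w))
    ≤-count-zeros w k≤d = ℕ.≤-trans (ℕ.m≤n⇒m≤n+o _ k≤d) (ℕ.≤-reflexive (≡.sym (count-zeros-++⁺ d w)))

    count-ones : ∀ w {k} → count 1F (toList w) ≡ k → count 1F (toList (List.replicate d 0F ++⁺ w)) ≡ k
    count-ones w = ≡.trans (count-ones-++⁺ d w)

  -- Here `N ≤ d` is what compares the ones with the zeros in the image of `0F`.
  σ-balanced : Balanced (σ N d)
  σ-balanced = record
    { 2≤zeros    = ≤-count-zeros (power 1F) 2≤d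
    ; 1≤zeros    = ℕ.≤-refl
    ; ones≤zeros = λ where
        0F → ℕ.≤-trans (ℕ.≤-reflexive (count-ones (power 1F) (count-power 1F))) (≤-count-zeros (power 1F) N≤d)
        1F → z≤n
    ; τ1≤τ0      = λ where
        0F → ≤-count-zeros (power 1F) (ℕ.<⇒≤ 2≤d)
        1F → z≤n
    }

  -- Here `N ≤ d` is what compares the zeros in the images of `1F` and `0F`.
  σ̂-balanced : Balanced (σ̂ N d)
  σ̂-balanced = record
    { 2≤zeros    = ≤-count-zeros (1F ∷ []) 2≤d
    ; 1≤zeros    = s≤s z≤n
    ; ones≤zeros = λ where
        0F → ℕ.≤-trans (ℕ.≤-reflexive (count-ones (1F ∷ []) ≡.refl)) (≤-count-zeros (1F ∷ []) (ℕ.<⇒≤ 2≤d))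
        1F → ℕ.≤-trans (ℕ.≤-reflexive (count-ones-replicate (ℕ.pred N))) z≤n
    ; τ1≤τ0      = λ where
        0F → ℕ.≤-trans (ℕ.≤-reflexive (count-power 0F)) (≤-count-zeros (1F ∷ []) N≤d)
        1F → ℕ.≤-trans (ℕ.≤-reflexive (count-ones-replicate (ℕ.pred N))) z≤n
    }

-- Digits of irrational numbers are at least N.

module Digits (em : ExcludedMiddle 0ℓ) (ℝ : CompleteOrderedField) where
  open OrderedField em ℝ
  open NCF em ℝ

  floor-exists : ∀ {y} → 0# ≤ y → ∃ (IsFloor y)
  floor-exists {y} 0≤y =
    let n , y≤n = archimedean y in first-floor (least em (λ n → y < fromℕ (suc n)) (n , bounded-by {n} y≤n))
    where
    bounded-by : ∀ {n} → y ≤ fromℕ n → y < fromℕ (suc n)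
    bounded-by {n} y≤n = ≰⇒> λ 1+n≤y → <⇒≱ 0<1 (linear (≤-trans 1+n≤y y≤n)
      (solve 1 (λ n → con (ℤ.+ 0) :- 𝟙 := n :- (𝟙 :+ n)) refl (fromℕ n)))
    first-floor : ∃[ m ] (y < fromℕ (suc m) × (∀ j → j ℕ.< m → ¬ (y < fromℕ (suc j)))) → ∃ (IsFloor y)
    first-floor (zero  , y<1 , _) = zero , 0≤y , y<1
    first-floor (suc m , y<m , first) with em {fromℕ (suc m) ≤ y}
    ... | yes m≤y = suc m , m≤y , y<m
    ... | no m≰y  = ⊥-elim (first m ℕ.≤-refl (≰⇒> m≰y))

  floor-correct : ∀ {y} → 0# ≤ y → IsFloor y ⌊ y ⌋
  floor-correct {y} 0≤y with em {∃ (IsFloor y)}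
  ... | yes (_ , isFloor) = isFloor
  ... | no none           = ⊥-elim (none (floor-exists 0≤y))

  -- No positive integer multiple is a natural number; for y ≥ 0 this is irrationality.
  Incommensurable : Carrier → Set
  Incommensurable y = ∀ a b → ¬ (fromℕ (suc b) * y ≈ fromℕ a)

  -- Elements of ℚ are fractions in lowest terms, so `a` and `suc b` are first divided by their
  -- greatest common divisor.
  irrational⇒incommensurable : ∀ {x} → Irrational x → Incommensurable x
  irrational⇒incommensurable {x} irrational a b bx≈a =
    lowest-terms (a ℕ./ g) (suc b ℕ./ g) (ℕ.m/n*n≡m (gcd[m,n]∣m a (suc b))) (ℕ.m/n*n≡m (gcd[m,n]∣n a (suc b))) (coprime-/gcd a (suc b))
    where
    g = gcd a (suc b)
    instance
      g-nonZero : NonZero g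
      g-nonZero = ℕ.≢-nonZero (gcd[m,n]≢0 a (suc b) (inj₂ λ ()))
    0<g : 0# < fromℕ g
    0<g = ≡.subst (λ n → 0# < fromℕ n) (ℕ.suc-pred g) (0<fromℕ-suc (ℕ.pred g))
    lowest-terms : ∀ p q → p ℕ.* g ≡ a → q ℕ.* g ≡ suc b → ¬ Coprime p q
    lowest-terms p (suc q) a≡ b≡ coprime = irrational (mkℚ (ℤ.+ p) q coprime) (begin
      x                                                 ≈⟨ *-identityˡ x ⟨
      1# * x                                            ≈⟨ *-congʳ (⁻¹-inverseʳ 0<q) ⟨
      fromℕ (suc q) * fromℕ (suc q) ⁻¹ * x              ≈⟨ solve 3 (λ q i x → q :* i :* x := (q :* x) :* i) refl (fromℕ (suc q)) (fromℕ (suc q) ⁻¹) x ⟩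
      fromℕ (suc q) * x * fromℕ (suc q) ⁻¹              ≈⟨ *-congʳ qx≈p ⟩
      fromℕ p * fromℕ (suc q) ⁻¹                        ∎)
      where
      open SetoidReasoning setoid
      0<q = 0<fromℕ-suc q
      qxg≈pg : fromℕ (suc q) * x * fromℕ g ≈ fromℕ p * fromℕ g
      qxg≈pg = begin
        fromℕ (suc q) * x * fromℕ g    ≈⟨ solve 3 (λ q x g → q :* x :* g := q :* g :* x) refl (fromℕ (suc q)) x (fromℕ g) ⟩
        fromℕ (suc q) * fromℕ g * x    ≈⟨ *-congʳ (fromℕ-* (suc q) g) ⟨
        fromℕ (suc q ℕ.* g) * x        ≡⟨ ≡.cong (λ k → fromℕ k * x) b≡ ⟩
        fromℕ (suc b) * x              ≈⟨ bx≈a ⟩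
        fromℕ a                        ≡⟨ ≡.cong fromℕ a≡ ⟨
        fromℕ (p ℕ.* g)                ≈⟨ fromℕ-* p g ⟩
        fromℕ p * fromℕ g              ∎
      qx≈p : fromℕ (suc q) * x ≈ fromℕ p
      qx≈p = antisym (cancel (≤-reflexive qxg≈pg)) (cancel (≤-reflexive (sym qxg≈pg)))
        where
        cancel : ∀ {y z} → y * fromℕ g ≤ z * fromℕ g → y ≤ z
        cancel le = *-cancelˡ-≤ 0<g (≤-respˡ-≈ (*-comm _ _) (≤-respʳ-≈ (*-comm _ _) le))

  record Admissible (y : Carrier) : Set where
    field
      0≤y            : 0# ≤ y
      y≤1            : y ≤ 1#
      incommensurable : Incommensurable y

    0<y : 0# < y
    0<y = 0≤y , λ 0≈y → incommensurable 0 0 (trans (*-congˡ (sym 0≈y)) (zeroʳ _))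

  module _ (N : ℕ) (1≤N : 1 ℕ.≤ N) where
    quotient-nonNeg : ∀ {y} → Admissible y → 0# ≤ N / y
    quotient-nonNeg adm = *-nonNeg (0≤fromℕ N) (proj₁ (⁻¹-pos (Admissible.0<y adm)))

    y*N/y : ∀ {y} → Admissible y → y * (N / y) ≈ fromℕ N
    y*N/y {y} adm = trans (solve 3 (λ y n i → y :* (n :* i) := (y :* i) :* n) refl y (fromℕ N) (y ⁻¹))
      (trans (*-congʳ (⁻¹-inverseʳ (Admissible.0<y adm))) (*-identityˡ _))

    -- A relation `(b + 1)(N / y - k) = a`, multiplied by `y`, becomes
    -- `(a + (b + 1) k) y = (b + 1) N`, which incommensurability of `y` excludes.
    T-admissible : ∀ {y} → Admissible y → Admissible (T N y)
    T-admissible {y} adm with em {y ≈ 0#}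
    ... | yes y≈0 = ⊥-elim (proj₂ (Admissible.0<y adm) (sym y≈0))
    ... | no _ = record
      { 0≤y = x≤y⇒0≤y-x (proj₁ floor)
      ; y≤1 = linear (proj₁ (proj₂ floor)) (solve 2 (λ q k → 𝟙 :- (q :- k) := (𝟙 :+ k) :- q) refl (N / y) (fromℕ k))
      ; incommensurable = λ a b eq → impossible a b (multiple a b eq)
      }
      where
      k = ⌊ N / y ⌋
      floor = floor-correct (quotient-nonNeg adm)
      multiple : ∀ a b → fromℕ (suc b) * (N / y - fromℕ k) ≈ fromℕ a → fromℕ (a ℕ.+ suc b ℕ.* k) * y ≈ fromℕ (suc b ℕ.* N)
      multiple a b eq = begin
        fromℕ (a ℕ.+ suc b ℕ.* k) * y                           ≈⟨ *-congʳ (trans (fromℕ-+ a _) (+-cong (sym eq) (fromℕ-* (suc b) k))) ⟩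
        (fromℕ (suc b) * (N / y - fromℕ k) + fromℕ (suc b) * fromℕ k) * y
          ≈⟨ solve 4 (λ b q k y → (b :* (q :- k) :+ b :* k) :* y := b :* (y :* q)) refl (fromℕ (suc b)) (N / y) (fromℕ k) y ⟩
        fromℕ (suc b) * (y * (N / y))                           ≈⟨ *-congˡ (y*N/y adm) ⟩
        fromℕ (suc b) * fromℕ N                                 ≈⟨ fromℕ-* (suc b) N ⟨
        fromℕ (suc b ℕ.* N)                                     ∎
        where open SetoidReasoning setoid
      impossible : ∀ a b → ¬ (fromℕ (a ℕ.+ suc b ℕ.* k) * y ≈ fromℕ (suc b ℕ.* N))
      impossible a b eq with a ℕ.+ suc b ℕ.* k
      ... | suc c = Admissible.incommensurable adm (suc b ℕ.* N) c eq
      -- If the factor of `y` is 0, the relation says that the positive number `(b + 1) N` is 0.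
      ... | zero  = <⇒≱ 0<1 (≤-respˡ-≈ fromℕ-1 (≤-trans (fromℕ-mono-≤ {1} (ℕ.*-mono-≤ (s≤s (z≤n {b})) 1≤N))
        (≤-reflexive (trans (sym eq) (zeroˡ y)))))

    N≤floor : ∀ {y} → Admissible y → N ℕ.≤ ⌊ N / y ⌋
    N≤floor {y} adm = ℕ.≮⇒≥ λ k<N → <⇒≱ (proj₂ (floor-correct (quotient-nonNeg adm))) (≤-trans (fromℕ-mono-≤ k<N) N≤N/y)
      where
      open Admissible adm
      N≤N/y : fromℕ N ≤ N / y
      N≤N/y = *-cancelˡ-≤ 0<y (≤-respʳ-≈ (trans (*-identityˡ _) (sym (y*N/y adm))) (*-monoʳ-≤ (0≤fromℕ N) y≤1))

    iterate-admissible : ∀ {x} → Admissible x → ∀ n → Admissible (fold x (T N) n)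
    iterate-admissible adm zero    = adm
    iterate-admissible adm (suc n) = T-admissible (iterate-admissible adm n)

    N≤digit : ∀ {x} → 0# ≤ x → x ≤ 1# → Irrational x → ∀ n → N ℕ.≤ digit N x n
    N≤digit 0≤x x≤1 irrational n = N≤floor (iterate-admissible
      (record { 0≤y = 0≤x ; y≤1 = x≤1 ; incommensurable = irrational⇒incommensurable irrational }) n)

corollary5p14 : (em : ∀ ℓ → ExcludedMiddle ℓ) (ℝ : CompleteOrderedField) →
    let open CompleteOrderedField ℝ
        open NCFSequence (em 0ℓ) ℝ
    in
    (N : ℕ) .{{_ : NonZero N}} → 2 ℕ.≤ N →
    (x : Carrier) → 0# ≤ x → x ≤ 1# → Irrational x →
    (∀ ω → IsNCFSequence N x ω → UniquelyErgodic ℝ (orbitClosure ω)) ×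
    (∀ ω̂ → IsDualNCFSequence N x ω̂ → UniquelyErgodic ℝ (orbitClosure ω̂))
corollary5p14 em ℝ N 2≤N x 0≤x x≤1 irrational =
  (λ ω limit → uniquelyErgodic (em 0ℓ) ℝ ω (uniform-rates (λ n → σ-balanced N 2≤N (N≤d n)) limit)) ,
  (λ ω̂ limit → uniquelyErgodic (em 0ℓ) ℝ ω̂ (uniform-rates (λ n → σ̂-balanced N 2≤N (N≤d n)) limit))
  where
  open Rates (em 0ℓ) ℝ using (uniform-rates)
  N≤d = Digits.N≤digit (em 0ℓ) ℝ N (ℕ.<⇒≤ 2≤N) 0≤x x≤1 irrational
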